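{- Let $G$ be a graph, $k\ge3$, and $U$ a set of $k$ elements disjoint from $V(G)$. If the $k$-suspension $G^U$ has a spanning tree, then $G^U$ has no 3-Pfaffian orientation.
   Context: The suspension $G^U$ of a graph $G=(V,E)$ from a finite set $U$ disjoint from $V$ is the 3-graph on $U\cup V$ with triples $\{i,j,u\}$ for all $ij\in E$ and $u\in U$; if $|U|=k$ it is a $k$-suspension. A cycle in a 3-graph is a sequence $a_0,t_1,a_1,\dots,t_\ell,a_\ell=a_0$, $\ell\ge2$, of distinct vertices $a_0,\dots,a_{\ell-1}$ and distinct triples with $a_{i-1},a_i\in t_i$; a spanning tree is a set of triples with no cycle, covering all vertices, connected via paths of triples. Identify the vertex set with $[N]$ via a linear order. A triple orientation $\omega$ assigns each triple $t=\{i,j,k\}$ a 3-cycle $\sigma(t,\omega)\in\{(i\,j\,k),(j\,i\,k)\}$; for a spanning tree $T$, $\prod_{t\in T}\sigma(t,\omega)$ is an $N$-cycle $(s(1)\cdots s(N))$ and $\mathrm{sgn}(T,\omega)$ is the sign of $s$ (well defined). $\omega$ is 3-Pfaffian if $\mathrm{sgn}(T,\omega)$ is constant over all spanning trees. -}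

module Defs where

open import Data.Nat using (ℕ; zero; suc; _+_; _≤_; _%_)
open import Data.Nat.DivMod using (_mod_)
open import Data.Bool using (Bool; true; false; if_then_else_; _∧_)
open import Data.Fin using (Fin; toℕ; _<_; _≟_; _<?_)
open import Data.Fin.Subset using (Subset; _∈_; _∉_)
open import Data.List using (List; []; _∷_; foldr; length; lookup; map; allFin)
open import Data.Nat.ListAction using (sum)
open import Data.List.Membership.Propositional using () renaming (_∈_ to _∈ₗ_)
open import Data.List.Relation.Unary.All using (All)
open import Data.List.Relation.Unary.Unique.Propositional using (Unique)
open import Data.Product using (Σ; _×_; _,_; ∃)
open import Data.Sum using (_⊎_)
open import Data.Empty using (⊥)
open import Relation.Nullary using (¬_)
open import Relation.Nullary.Decidable using (⌊_⌋; does)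
open import Relation.Binary.PropositionalEquality using (_≡_)
open import Function using (id; _∘_)
open import Function.Definitions using (Injective)

next : ∀ {n} → Fin n → Fin n
next {suc n} i = suc (toℕ i) mod (suc n)

-- Graphs.  A graph G on the vertex set V = complement of U inside Fin N,
-- given by a symmetric irreflexive adjacency relation whose edges avoid U.
-- The whole vertex set U ∪ V is Fin N (identification via a linear order).

record IsGraphOff {N : ℕ} (U : Subset N) (E : Fin N → Fin N → Set) : Set where
  field
    sym     : ∀ {i j} → E i j → E j i
    irrefl  : ∀ {i} → ¬ E i i
    avoidsU : ∀ {i j} → E i j → i ∉ U

-- Triples of vertices, represented by their increasing listing (a , b , c).
Triple : ℕ → Set
Triple N = Fin N × Fin N × Fin N

Sorted : ∀ {N} → Triple N → Set
Sorted (a , b , c) = (a < b) × (b < c)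

_∈ₜ_ : ∀ {N} → Fin N → Triple N → Set
v ∈ₜ (a , b , c) = (v ≡ a) ⊎ (v ≡ b) ⊎ (v ≡ c)

IsSuspTriple : ∀ {N} (U : Subset N) (E : Fin N → Fin N → Set) → Triple N → Set
IsSuspTriple U E (a , b , c) =
  Sorted (a , b , c) ×
  (((a ∈ U) × E b c) ⊎ ((b ∈ U) × E a c) ⊎ ((c ∈ U) × E a b))

-- Cycles, connectivity and spanning trees in a set T of triples
-- (T is a duplicate-free list of triples).

record Cycle {N : ℕ} (T : List (Triple N)) : Set where
  field
    ℓ      : ℕ
    ℓ≥2    : 2 ≤ ℓ
    vert   : Fin ℓ → Fin N
    trip   : Fin ℓ → Fin (length T)
    vert-inj : Injective _≡_ _≡_ vert
    trip-inj : Injective _≡_ _≡_ trip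
    here-in : ∀ i → vert i ∈ₜ lookup T (trip i)
    next-in : ∀ i → vert (next i) ∈ₜ lookup T (trip i)

data Reach {N : ℕ} (T : List (Triple N)) : Fin N → Fin N → Set where
  one  : ∀ {x y t} → t ∈ₗ T → x ∈ₜ t → y ∈ₜ t → Reach T x y
  step : ∀ {x y z t} → Reach T x y → t ∈ₗ T → y ∈ₜ t → z ∈ₜ t → Reach T x z

record SpanningTree {N : ℕ} (U : Subset N) (E : Fin N → Fin N → Set)
                    (T : List (Triple N)) : Set where
  field
    edges     : All (IsSuspTriple U E) T
    distinct  : Unique T
    acyclic   : ¬ Cycle T
    covering  : ∀ v → ∃ λ t → (t ∈ₗ T) × (v ∈ₜ t)
    connected : ∀ x y → Reach T x y

cyc3 : ∀ {N} → Fin N → Fin N → Fin N → Fin N → Fin N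
cyc3 i j k x =
  if does (x ≟ i) then j else
  if does (x ≟ j) then k else
  if does (x ≟ k) then i else x

-- A triple orientation: for each triple (a,b,c), a < b < c, a Boolean choosing
-- σ(t,ω) = (a b c) (true) or (b a c) (false).
Orientation : ℕ → Set
Orientation N = Triple N → Bool

σ : ∀ {N} → Triple N → Orientation N → Fin N → Fin N
σ (a , b , c) ω = if ω (a , b , c) then cyc3 a b c else cyc3 b a c

prodσ : ∀ {N} → List (Triple N) → Orientation N → Fin N → Fin N
prodσ T ω = foldr (λ t f → σ t ω ∘ f) id T

IsCycleOf : ∀ {N} → (Fin N → Fin N) → (Fin N → Fin N) → Set
IsCycleOf {N} p s = Injective _≡_ _≡_ s × (∀ i → p (s i) ≡ s (next i))

inversions : ∀ {N} → (Fin N → Fin N) → ℕ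
inversions {N} s =
  sum (map (λ i → sum (map (λ j →
        if ⌊ i <? j ⌋ ∧ ⌊ s j <? s i ⌋ then 1 else 0) (allFin N))) (allFin N))

-- sign of s, encoded as the parity of its inversion number (0 ↔ +1, 1 ↔ -1)
sgn : ∀ {N} → (Fin N → Fin N) → ℕ
sgn s = inversions s % 2

Is3Pfaffian : ∀ {N} (U : Subset N) (E : Fin N → Fin N → Set) → Orientation N → Set
Is3Pfaffian {N} U E ω =
  ∀ (T₁ T₂ : List (Triple N)) (s₁ s₂ : Fin N → Fin N) →
  SpanningTree U E T₁ → SpanningTree U E T₂ →
  IsCycleOf (prodσ T₁ ω) s₁ → IsCycleOf (prodσ T₂ ω) s₂ →
  sgn s₁ ≡ sgn s₂

{-# OPTIONS --safe #-}
-- Suppose a spanning tree contains triples abx and bcy with x ≠ y in U and b ∉ U. Permuting U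
-- is an automorphism of the suspension, so for any two members x, y of a three-element subset
-- of U some tree contains abx and bcy. Trading the two for aby and bcx gives another spanning
-- tree. In a tree, the product of the 3-cycles of the other triples has five cycles, through
-- a, b, c, x and y, each of odd length, and the trade transposes the blocks of x and y in the
-- N-cycle; so it flips the sign, up to the choices made by ω on the four triples. Hence, with
-- r(u) recording the choices of ω on abu and bcu, a 3-Pfaffian ω has r(x) ≠ r(y) for any two
-- of three elements, although r takes two values. Such adjacent triples exist, since
-- otherwise distinct elements of U would not be connected.
module Submission where

open import Defs
open import Data.Nat as ℕ using (ℕ; zero; suc; _+_; _≤_; _%_; z≤n; s≤s)
open import Data.Nat.Properties as ℕₚ using (1+n≢n; +-suc; +-identityʳ; ≤-antisym)
open import Data.Nat.DivMod using (%-distribˡ-+; m<n⇒m%n≡m; n%n≡0; m%n<n; m%n%n≡m%n; [m+n]%n≡m%n)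
open import Data.Nat.ListAction using (sum)
open import Data.Bool using (Bool; true; false; not; if_then_else_; _∧_; _xor_)
open import Data.Bool.Properties using (xor-assoc; xor-comm; xor-identityʳ; xor-same; not-distribˡ-xor)
open import Data.Bool.Solver using (module xor-∧-Solver)
open import Data.Fin using (Fin; zero; suc; toℕ; fromℕ; inject₁; _≟_; _<_; _<?_)
open import Data.Fin.Properties
  using (<-cmp; <-asym; <-trans; <⇒≢; toℕ-injective; toℕ-fromℕ<; toℕ-fromℕ; toℕ-inject₁; toℕ<n; any?; injective⇒≤)
open import Data.Fin.Permutation.Components using (transpose; transpose-inverse)
open import Data.Fin.Relation.Unary.Top using (View; ‵fromℕ; ‵inj₁; ‵inject₁; view)
open import Data.Fin.Subset using (Subset; ∣_∣; ⁅_⁆; _∪_; inside; outside)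
  renaming (_∈_ to _∈ᵤ_; _∉_ to _∉ᵤ_)
open import Data.Fin.Subset.Properties using (p⊆q⇒∣p∣≤∣q∣; x∈⁅x⁆; ∣⁅x⁆∣≡1; x∈p∪q⁺)
open import Data.List using (List; []; _∷_; _++_; map; length; lookup; allFin; [_])
open import Data.List.Properties using (++-assoc; ++-identityʳ; map-tabulate; map-cong)
open import Data.List.Membership.Propositional using () renaming (_∈_ to _∈ₗ_; _∉_ to _∉ₗ_)
open import Data.List.Membership.Propositional.Properties
  using (∈-map⁺; ∈-map⁻; ∈-lookup; ∈-++⁺ˡ; ∈-++⁺ʳ; ∈-++⁻; ∈-∃++)
import Data.List.Membership.DecPropositional as ListMembership
open import Data.List.Relation.Unary.Any using (here; there; index)
open import Data.List.Relation.Unary.Any.Properties using (lookup-index)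
open import Data.List.Relation.Unary.All as All using (All; []; _∷_)
import Data.List.Relation.Unary.All.Properties as All
open import Data.List.Relation.Unary.AllPairs using ([]; _∷_)
open import Data.List.Relation.Unary.Unique.Propositional using (Unique)
open import Data.List.Relation.Unary.Unique.Propositional.Properties using (Unique[x∷xs]⇒x∉xs; ++⁺)
open import Data.List.Relation.Binary.Disjoint.Propositional using (Disjoint)
open import Data.List.Relation.Binary.Pointwise using (Pointwise; []; _∷_)
import Data.List.Relation.Binary.Permutation.Setoid as Permutation
import Data.List.Relation.Binary.Permutation.Setoid.Properties as Perm
open import Data.Vec as Vec using (Vec; []; _∷_)
open import Data.Vec.Membership.Propositional using () renaming (_∈_ to _∈ᵥ_; _∉_ to _∉ᵥ_)
open import Data.Vec.Membership.Propositional.Properties using () renaming (∈-lookup to ∈ᵥ-lookup)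
import Data.Vec.Membership.DecPropositional as VecMembership
open import Data.Vec.Relation.Unary.Any as VAny using ()
open import Data.Product using (Σ; _×_; _,_; proj₁; proj₂; ∃; ∃-syntax)
open import Data.Product.Properties using (≡-dec)
open import Data.Sum using (_⊎_; inj₁; inj₂; [_,_]′)
open import Data.Empty using (⊥; ⊥-elim)
open import Relation.Nullary using (¬_; yes; no; Dec)
open import Relation.Nullary.Decidable using (⌊_⌋; does; isYes≗does; dec-true; dec-false)
open import Relation.Binary using (DecidableEquality; tri<; tri≈; tri>)
open import Relation.Binary.PropositionalEquality hiding ([_])
open import Function using (_∘_; id)
open import Function.Definitions using (Injective)

-- The odd lengths have a simple origin: a forest grown triple by triple starts from one-point
-- orbits, and each new 3-cycle chains three orbits into one, so lengths stay odd. Transposing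
-- neighbouring blocks X and Y changes the inversion parity by |X||Y|, which is odd here. The same
-- fact accounts for ω: reversing one of the two distinguished triples also transposes two
-- neighbouring odd blocks, so every choice contributes its own factor -1, and comparing signs
-- becomes a linear relation between bits. With all four triples oriented along their listings, the
-- two N-cycles read from a are A B C Y X and A B C X Y, capitals being the blocks of the vertices.
-- The N-cycle depends on the order of multiplication. As `Is3Pfaffian` compares all listings of all
-- trees, the two triples can be listed first, so that their 3-cycles are applied after those of the
-- common rest.

private variable
  N M m n     : ℕ
  A           : Set
  u v x y z   : Fin N
  s t         : Triple N
  R S T       : List (Triple N)
  p ρ τ       : Fin N → Fin N
  w w′        : List (Fin N)

-- Parity of inversions

odd : List A → Bool
odd []      = false
odd (_ ∷ w) = not (odd w)

odd-++ : (v w : List A) → odd (v ++ w) ≡ odd v xor odd w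
odd-++ []      w = refl
odd-++ (_ ∷ v) w rewrite odd-++ v w with odd v | odd w
... | true  | true  = refl
... | true  | false = refl
... | false | _     = refl

-- Parities, as elements of the Boolean ring: of the number of entries of w below x,
-- of the inversions of w, and of the pairs (b , c) in B × C with c below b.
below : Fin M → List (Fin M) → Bool
below x []      = false
below x (y ∷ w) = ⌊ y <? x ⌋ xor below x w

par : List (Fin M) → Bool
par []      = false
par (x ∷ w) = below x w xor par w

cross : List (Fin M) → List (Fin M) → Bool
cross []      C = false
cross (x ∷ B) C = below x C xor cross B C

open xor-∧-Solver using (solve; _:=_; _:+_; _:*_; con)

below-++ : (x : Fin M) (B C : List (Fin M)) → below x (B ++ C) ≡ below x B xor below x C
below-++ x []      C = refl
below-++ x (y ∷ B) C rewrite below-++ x B C =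
  sym (xor-assoc ⌊ y <? x ⌋ (below x B) (below x C))

cross-++ˡ : (B C D : List (Fin M)) → cross (B ++ C) D ≡ cross B D xor cross C D
cross-++ˡ []      C D = refl
cross-++ˡ (x ∷ B) C D rewrite cross-++ˡ B C D =
  sym (xor-assoc (below x D) (cross B D) (cross C D))

cross-++ʳ : (B C D : List (Fin M)) → cross B (C ++ D) ≡ cross B C xor cross B D
cross-++ʳ []      C D = refl
cross-++ʳ (x ∷ B) C D rewrite cross-++ʳ B C D | below-++ x C D =
  solve 4 (λ a b c d → (a :+ b) :+ (c :+ d) := (a :+ c) :+ (b :+ d)) refl
    (below x C) (below x D) (cross B C) (cross B D)

par-++ : (B C : List (Fin M)) → par (B ++ C) ≡ (par B xor par C) xor cross B C
par-++ []      C = sym (xor-identityʳ (par C))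
par-++ (x ∷ B) C rewrite par-++ B C | below-++ x B C =
  solve 5 (λ a b c d e → (a :+ b) :+ ((c :+ d) :+ e) := ((a :+ c) :+ d) :+ (b :+ e)) refl
    (below x B) (below x C) (par B) (par C) (cross B C)

isYes-true : {P : Set} (P? : Dec P) → P → ⌊ P? ⌋ ≡ true
isYes-true P? p = trans (isYes≗does P?) (dec-true P? p)

isYes-false : {P : Set} (P? : Dec P) → ¬ P → ⌊ P? ⌋ ≡ false
isYes-false P? ¬p = trans (isYes≗does P?) (dec-false P? ¬p)

<?-xor : {x y : Fin M} → x ≢ y → ⌊ x <? y ⌋ xor ⌊ y <? x ⌋ ≡ true
<?-xor {x = x} {y} x≢y with <-cmp x y
... | tri< x<y _ y≮x = cong₂ _xor_ (isYes-true (x <? y) x<y) (isYes-false (y <? x) y≮x)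
... | tri≈ _ x≡y _ = ⊥-elim (x≢y x≡y)
... | tri> x≮y _ y<x = cong₂ _xor_ (isYes-false (x <? y) x≮y) (isYes-true (y <? x) y<x)

-- For each entry c of C exactly one of c < b and b < c holds, so every entry contributes once to
-- the sum.
below-cross : (b : Fin M) (C : List (Fin M)) → b ∉ₗ C → below b C xor cross C [ b ] ≡ odd C
below-cross b []      b∉ = refl
below-cross b (c ∷ C) b∉ = trans
  (solve 4 (λ p q r s → (p :+ q) :+ ((r :+ con false) :+ s) := (p :+ r) :+ (q :+ s)) refl
    ⌊ c <? b ⌋ (below b C) ⌊ b <? c ⌋ (cross C [ b ]))
  (cong₂ _xor_ (<?-xor {x = c} {b} λ { refl → b∉ (here refl) }) (below-cross b C (b∉ ∘ there)))

cross-swap : (B C : List (Fin M)) → Disjoint B C → cross B C xor cross C B ≡ odd B ∧ odd C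
cross-swap []      C dis = cross-[] C
  where
  cross-[] : (C : List (Fin M)) → cross C [] ≡ false
  cross-[] []      = refl
  cross-[] (_ ∷ C) = cross-[] C
cross-swap (b ∷ B) C dis = begin
  (below b C xor cross B C) xor cross C (b ∷ B)
    ≡⟨ cong ((below b C xor cross B C) xor_) (cross-++ʳ C [ b ] B) ⟩
  (below b C xor cross B C) xor (cross C [ b ] xor cross C B)
    ≡⟨ solve 4 (λ p q r s → (p :+ q) :+ (r :+ s) := (p :+ r) :+ (q :+ s)) refl
         (below b C) (cross B C) (cross C [ b ]) (cross C B) ⟩
  (below b C xor cross C [ b ]) xor (cross B C xor cross C B)
    ≡⟨ cong₂ _xor_ (below-cross b C λ b∈C → dis (here refl , b∈C))
                   (cross-swap B C λ (p , q) → dis (there p , q)) ⟩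
  odd C xor (odd B ∧ odd C)
    ≡⟨ solve 2 (λ p q → p :+ q :* p := (con true :+ q) :* p) refl (odd C) (odd B) ⟩
  not (odd B) ∧ odd C ∎
  where open ≡-Reasoning

-- Only the pairs between B and C notice the exchange. By `cross-swap` their two counts add up to
-- |B||C|, which is odd.
par-swap : (P B C Q : List (Fin M)) → odd B ≡ true → odd C ≡ true → Disjoint B C →
           par (P ++ (B ++ C) ++ Q) ≡ not (par (P ++ (C ++ B) ++ Q))
par-swap P B C Q oB oC dis = begin
  par (P ++ (B ++ C) ++ Q)            ≡⟨ expand B C ⟩
  (even B C xor cross B C)            ≡⟨ cong (even B C xor_) cross-BC ⟩
  even B C xor not (cross C B)        ≡⟨ rearrange ⟩
  not (even C B xor cross C B)        ≡⟨ cong not (expand C B) ⟨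
  not (par (P ++ (C ++ B) ++ Q))      ∎
  where
  open ≡-Reasoning
  even : (B C : List (Fin _)) → Bool
  even B C = (par P xor par Q xor cross P Q) xor
             ((par B xor cross P B xor cross B Q) xor (par C xor cross P C xor cross C Q))
  expand : ∀ B C → par (P ++ (B ++ C) ++ Q) ≡ even B C xor cross B C
  expand B C rewrite par-++ P ((B ++ C) ++ Q) | par-++ (B ++ C) Q | par-++ B C
                   | cross-++ʳ P (B ++ C) Q | cross-++ʳ P B C | cross-++ˡ B C Q =
    solve 10 (λ p b c q bc pb pc pq bq cq →
        (p :+ ((((b :+ c) :+ bc) :+ q) :+ (bq :+ cq))) :+ ((pb :+ pc) :+ pq)
        := ((p :+ (q :+ pq)) :+ ((b :+ (pb :+ bq)) :+ (c :+ (pc :+ cq)))) :+ bc) refl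
      (par P) (par B) (par C) (par Q) (cross B C) (cross P B) (cross P C) (cross P Q)
      (cross B Q) (cross C Q)
  cross-BC : cross B C ≡ not (cross C B)
  cross-BC with cross B C | cross C B | cross-swap B C dis
  ... | true  | true  | e rewrite oB | oC = sym e
  ... | true  | false | _ = refl
  ... | false | true  | _ = refl
  ... | false | false | e rewrite oB | oC = e
  rearrange : even B C xor not (cross C B) ≡ not (even C B xor cross C B)
  rearrange = solve 4 (λ a b c d → (a :+ (b :+ c)) :+ (con true :+ d)
                                   := con true :+ ((a :+ (c :+ b)) :+ d)) refl
    (par P xor par Q xor cross P Q) (par B xor cross P B xor cross B Q)
    (par C xor cross P C xor cross C Q) (cross C B)

-- `inversions` with domain and codomain separated: induction on a list shortens the domain of
-- `lookup` while the entries stay in `Fin M`.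
inv : (Fin n → Fin M) → ℕ
inv {n} s = sum (map (λ i → sum (map (λ j →
  if ⌊ i <? j ⌋ ∧ ⌊ s j <? s i ⌋ then 1 else 0) (allFin n))) (allFin n))

toBit : Bool → ℕ
toBit b = if b then 1 else 0

toBit-injective : ∀ {b c} → toBit b ≡ toBit c → b ≡ c
toBit-injective {true}  {true}  _ = refl
toBit-injective {false} {false} _ = refl

toBit-+ : ∀ b c → (toBit b + toBit c) % 2 ≡ toBit (b xor c)
toBit-+ true  true  = refl
toBit-+ true  false = refl
toBit-+ false true  = refl
toBit-+ false false = refl

%2-+ : ∀ {m m′ : ℕ} {b c} → m % 2 ≡ toBit b → m′ % 2 ≡ toBit c → (m + m′) % 2 ≡ toBit (b xor c)
%2-+ {m} {m′} {b} {c} p q = trans (%-distribˡ-+ m m′ 2)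
  (trans (cong₂ (λ x y → (x + y) % 2) p q) (toBit-+ b c))

sum-cons : (f : Fin (suc n) → ℕ) → sum (map f (allFin (suc n))) ≡ f zero + sum (map (f ∘ suc) (allFin n))
sum-cons {n} f = cong ((f zero +_) ∘ sum)
  (trans (map-tabulate suc f) (sym (map-tabulate id (f ∘ suc))))

row-parity : (x : Fin M) (w : List (Fin M)) →
  sum (map (λ j → toBit ⌊ lookup w j <? x ⌋) (allFin (length w))) % 2 ≡ toBit (below x w)
row-parity x []      = refl
row-parity x (y ∷ w) rewrite sum-cons (λ j → toBit ⌊ lookup (y ∷ w) j <? x ⌋) =
  %2-+ {toBit ⌊ y <? x ⌋} (bit ⌊ y <? x ⌋) (row-parity x w)
  where
  bit : ∀ b → toBit b % 2 ≡ toBit b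
  bit true  = refl
  bit false = refl

suc-<? : (i j : Fin n) → ⌊ suc i <? suc j ⌋ ≡ ⌊ i <? j ⌋
suc-<? i j = trans (isYes≗does (suc i <? suc j)) (sym (isYes≗does (i <? j)))

inv-parity : (w : List (Fin M)) → inv (lookup w) % 2 ≡ toBit (par w)
inv-parity []      = refl
inv-parity (x ∷ w) = trans (cong (_% 2) inv-cons)
  (%2-+ {sum (map (λ j → toBit ⌊ lookup w j <? x ⌋) (allFin (length w)))} (row-parity x w) (inv-parity w))
  where
  entry : Fin (suc (length w)) → Fin (suc (length w)) → ℕ
  entry i j = toBit (⌊ i <? j ⌋ ∧ ⌊ lookup (x ∷ w) j <? lookup (x ∷ w) i ⌋)
  inv-cons : inv (lookup (x ∷ w)) ≡
             sum (map (λ j → toBit ⌊ lookup w j <? x ⌋) (allFin (length w))) + inv (lookup w)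
  inv-cons = trans (sum-cons (λ i → sum (map (entry i) (allFin _))))
    (cong₂ _+_ (sum-cons (entry zero))
      (cong sum (map-cong (λ i → trans (sum-cons (entry (suc i)))
        (cong sum (map-cong (λ j → cong (λ b → toBit (b ∧ ⌊ lookup w j <? lookup w i ⌋)) (suc-<? i j))
                            (allFin _)))) (allFin (length w)))))

-- Connectivity and forests

pattern fst∈ = inj₁ refl
pattern snd∈ = inj₂ (inj₁ refl)
pattern trd∈ = inj₂ (inj₂ refl)

-- Unlike `Reach`, this is reflexive at vertices in no triple, which is needed for the partial
-- forests met in inductions.
data Conn {N} (S : List (Triple N)) (x : Fin N) : Fin N → Set where
  stop : Conn S x x
  move : Conn S x y → t ∈ₗ S → y ∈ₜ t → z ∈ₜ t → Conn S x z

conn-triple : t ∈ₗ S → x ∈ₜ t → y ∈ₜ t → Conn S x y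
conn-triple = move stop

conn-trans : Conn S x y → Conn S y z → Conn S x z
conn-trans c stop            = c
conn-trans c (move d t∈ p q) = move (conn-trans c d) t∈ p q

conn-sym : Conn S x y → Conn S y x
conn-sym stop            = stop
conn-sym (move c t∈ p q) = conn-trans (conn-triple t∈ q p) (conn-sym c)

conn-map : (f : Fin N → Fin N) →
  (∀ {t x y} → t ∈ₗ S → x ∈ₜ t → y ∈ₜ t → Conn T (f x) (f y)) → Conn S x y → Conn T (f x) (f y)
conn-map f g stop            = stop
conn-map f g (move c t∈ p q) = conn-trans (conn-map f g c) (g t∈ p q)

conn-bind : (∀ {t x y} → t ∈ₗ S → x ∈ₜ t → y ∈ₜ t → Conn T x y) → Conn S x y → Conn T x y
conn-bind = conn-map id

conn-there : Conn S x y → Conn (t ∷ S) x y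
conn-there = conn-bind (conn-triple ∘ there)

-- A walk that uses t is cut at its first entry into t and its last exit from t.
conn-split : Conn (t ∷ S) x y →
  Conn S x y ⊎ (∃[ u ] ∃[ v ] (u ∈ₜ t × v ∈ₜ t × Conn S x u × Conn S v y))
conn-split stop = inj₁ stop
conn-split (move c t∈ p q) with conn-split c | t∈
... | inj₁ d                     | here refl = inj₂ (_ , _ , p , q , d , stop)
... | inj₁ d                     | there t∈′ = inj₁ (move d t∈′ p q)
... | inj₂ (u , v , u∈ , _  , d , _) | here refl = inj₂ (u , _ , u∈ , q , d , stop)
... | inj₂ (u , v , u∈ , v∈ , d , e) | there t∈′ = inj₂ (u , v , u∈ , v∈ , d , move e t∈′ p q)

Apart : List (Triple N) → Triple N → Set
Apart S (i , j , k) = ¬ Conn S i j × ¬ Conn S i k × ¬ Conn S j k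

apart≡ : Apart S t → x ∈ₜ t → y ∈ₜ t → Conn S x y → x ≡ y
apart≡ _             fst∈ fst∈ c = refl
apart≡ (ij , _ , _)  fst∈ snd∈ c = ⊥-elim (ij c)
apart≡ (_ , ik , _)  fst∈ trd∈ c = ⊥-elim (ik c)
apart≡ (ij , _ , _)  snd∈ fst∈ c = ⊥-elim (ij (conn-sym c))
apart≡ _             snd∈ snd∈ c = refl
apart≡ (_ , _ , jk)  snd∈ trd∈ c = ⊥-elim (jk c)
apart≡ (_ , ik , _)  trd∈ fst∈ c = ⊥-elim (ik (conn-sym c))
apart≡ (_ , _ , jk)  trd∈ snd∈ c = ⊥-elim (jk (conn-sym c))
apart≡ _             trd∈ trd∈ c = refl

-- Acyclicity in a form fit for induction: each triple joins three different components of the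
-- triples listed after it.
data Forest {N} : List (Triple N) → Set where
  []  : Forest []
  _∷_ : Apart S t → Forest S → Forest (t ∷ S)

-- Simple paths: the vertices visited before the endpoint and the triples used, most recent first.
data Path {N} (T : List (Triple N)) (x : Fin N) :
          ∀ {m} → Fin N → Vec (Fin N) m → Vec (Triple N) m → Set where
  stop : Path T x x [] []
  move : ∀ {vs : Vec (Fin N) m} {ts} → Path T x y vs ts → t ∈ₗ T → y ∈ₜ t → z ∈ₜ t →
         z ∉ᵥ (y ∷ vs) → t ∉ᵥ ts → Path T x z (y ∷ vs) (t ∷ ts)

SimplePath : List (Triple N) → Fin N → Fin N → Set
SimplePath T x y = ∃[ m ] Σ (Vec _ m) λ vs → Σ (Vec _ m) λ ts → Path T x y vs ts

_≟ₜ_ : DecidableEquality (Triple N)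
_≟ₜ_ = ≡-dec _≟_ (≡-dec _≟_ _≟_)

truncate-at-vertex : {vs : Vec (Fin N) m} {ts : Vec (Triple N) m} →
  Path T x y vs ts → z ∈ᵥ (y ∷ vs) → SimplePath T x z
truncate-at-vertex p                  (VAny.here refl) = _ , _ , _ , p
truncate-at-vertex (move p _ _ _ _ _) (VAny.there z∈)  = truncate-at-vertex p z∈

truncate-at-triple : {vs : Vec (Fin N) m} {ts : Vec (Triple N) m} →
  Path T x y vs ts → t ∈ᵥ ts →
  ∃[ z ] (z ∈ₜ t × ∃[ n ] Σ (Vec _ n) λ vs → Σ (Vec _ n) λ ts → Path T x z vs ts × t ∉ᵥ ts)
truncate-at-triple (move p _ y∈t _ _ t∉) (VAny.here refl) = _ , y∈t , _ , _ , _ , p , t∉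
truncate-at-triple (move p _ _ _ _ _)    (VAny.there t∈)  = truncate-at-triple p t∈

extend-path : {vs : Vec (Fin N) m} {ts : Vec (Triple N) m} →
  Path T x y vs ts → t ∈ₗ T → y ∈ₜ t → z ∈ₜ t → t ∉ᵥ ts → SimplePath T x z
extend-path {y = y} {z = z} {vs = vs} p t∈ y∈ z∈ t∉ts with VecMembership._∈?_ _≟_ z (y ∷ vs)
... | yes z∈vs = truncate-at-vertex p z∈vs
... | no  z∉vs = _ , _ , _ , move p t∈ y∈ z∈ z∉vs t∉ts

-- Shortcuts keep the path simple: if the next triple was used before, cut back to where the path
-- entered it and leave it at the new end; if the new end was visited before, cut back to that
-- visit.
conn→path : Conn T x y → SimplePath T x y
conn→path stop = _ , _ , _ , stop
conn→path (move {t = t} c t∈ y∈ z∈) with conn→path c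
... | _ , _ , ts , p with VecMembership._∈?_ _≟ₜ_ t ts
...   | no  t∉ts = extend-path p t∈ y∈ z∈ t∉ts
...   | yes t∈ts = let _ , w∈ , _ , _ , _ , q , t∉ = truncate-at-triple p t∈ts
                   in extend-path q t∈ w∈ z∈ t∉

-- The cyclic successor on `Fin n` and its iterates

toℕ-next : ∀ {n} (i : Fin (suc n)) → toℕ (next i) ≡ suc (toℕ i) % suc n
toℕ-next {n} i = toℕ-fromℕ< (m%n<n (suc (toℕ i)) (suc n))

next-inject₁ : ∀ {n} (i : Fin n) → next (inject₁ i) ≡ suc i
next-inject₁ {n} i = toℕ-injective (begin
  toℕ (next (inject₁ i))          ≡⟨ toℕ-next (inject₁ i) ⟩
  suc (toℕ (inject₁ i)) % suc n   ≡⟨ m<n⇒m%n≡m (s≤s (subst (ℕ._< n) (sym (toℕ-inject₁ i)) (toℕ<n i))) ⟩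
  suc (toℕ (inject₁ i))           ≡⟨ cong suc (toℕ-inject₁ i) ⟩
  suc (toℕ i)                     ∎)
  where open ≡-Reasoning

next-fromℕ : ∀ n → next (fromℕ n) ≡ zero
next-fromℕ n = toℕ-injective (trans (toℕ-next (fromℕ n))
  (trans (cong (λ k → suc k % suc n) (toℕ-fromℕ n)) (n%n≡0 (suc n))))

next≢ : ∀ {n} → 2 ≤ n → (i : Fin n) → next i ≢ i
next≢ {suc (suc n)} (s≤s (s≤s _)) i eq with view i
... | ‵fromℕ with trans (sym (next-fromℕ (suc n))) eq
...   | ()
next≢ {suc (suc n)} (s≤s (s≤s _)) i eq | ‵inject₁ j =
  1+n≢n (trans (cong toℕ (trans (sym (next-inject₁ j)) eq)) (toℕ-inject₁ j))

nexts : ∀ {n} → ℕ → Fin n → Fin n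
nexts zero    i = i
nexts (suc m) i = nexts m (next i)

toℕ-nexts : ∀ {n} m (i : Fin (suc n)) → toℕ (nexts m i) ≡ (toℕ i + m) % suc n
toℕ-nexts {n} zero i rewrite +-identityʳ (toℕ i) = sym (m<n⇒m%n≡m (toℕ<n i))
toℕ-nexts {n} (suc m) i = begin
  toℕ (nexts m (next i))                     ≡⟨ toℕ-nexts m (next i) ⟩
  (toℕ (next i) + m) % suc n                 ≡⟨ cong (λ k → (k + m) % suc n) (toℕ-next i) ⟩
  (suc (toℕ i) % suc n + m) % suc n          ≡⟨ %-distribˡ-+ (suc (toℕ i) % suc n) m (suc n) ⟩
  (suc (toℕ i) % suc n % suc n + m % suc n) % suc n
    ≡⟨ cong (λ k → (k + m % suc n) % suc n) (m%n%n≡m%n (suc (toℕ i)) (suc n)) ⟩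
  (suc (toℕ i) % suc n + m % suc n) % suc n  ≡⟨ %-distribˡ-+ (suc (toℕ i)) m (suc n) ⟨
  (suc (toℕ i) + m) % suc n                  ≡⟨ cong (_% suc n) (+-suc (toℕ i) m) ⟨
  (toℕ i + suc m) % suc n                    ∎
  where open ≡-Reasoning

nexts-period : ∀ {n} (i : Fin (suc n)) → nexts n (next i) ≡ i
nexts-period {n} i = toℕ-injective (begin
  toℕ (nexts (suc n) i)    ≡⟨ toℕ-nexts (suc n) i ⟩
  (toℕ i + suc n) % suc n  ≡⟨ [m+n]%n≡m%n (toℕ i) (suc n) ⟩
  toℕ i % suc n            ≡⟨ m<n⇒m%n≡m (toℕ<n i) ⟩
  toℕ i                    ∎)
  where open ≡-Reasoning

path-vertices-distinct : {vs : Vec (Fin N) m} {ts : Vec (Triple N) m} →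
  Path T x y vs ts → Injective _≡_ _≡_ (Vec.lookup (y ∷ vs))
path-vertices-distinct p {zero}  {zero}  eq = refl
path-vertices-distinct (move p _ _ _ z∉ _) {zero}  {suc j} eq =
  ⊥-elim (z∉ (subst (_∈ᵥ _) (sym eq) (∈ᵥ-lookup j _)))
path-vertices-distinct (move p _ _ _ z∉ _) {suc i} {zero}  eq =
  ⊥-elim (z∉ (subst (_∈ᵥ _) eq (∈ᵥ-lookup i _)))
path-vertices-distinct (move p _ _ _ _ _)  {suc i} {suc j} eq = cong suc (path-vertices-distinct p eq)

path-triples-distinct : {vs : Vec (Fin N) m} {ts : Vec (Triple N) m} →
  Path T x y vs ts → Injective _≡_ _≡_ (Vec.lookup ts)
path-triples-distinct (move p _ _ _ _ _)  {zero}  {zero}  eq = refl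
path-triples-distinct (move p _ _ _ _ t∉) {zero}  {suc j} eq =
  ⊥-elim (t∉ (subst (_∈ᵥ _) (sym eq) (∈ᵥ-lookup j _)))
path-triples-distinct (move p _ _ _ _ t∉) {suc i} {zero}  eq =
  ⊥-elim (t∉ (subst (_∈ᵥ _) eq (∈ᵥ-lookup i _)))
path-triples-distinct (move p _ _ _ _ _)  {suc i} {suc j} eq = cong suc (path-triples-distinct p eq)

path-incidence : {vs : Vec (Fin N) m} {ts : Vec (Triple N) m} → Path T x y vs ts → ∀ i →
  Vec.lookup ts i ∈ₗ T × Vec.lookup (y ∷ vs) (inject₁ i) ∈ₜ Vec.lookup ts i
                       × Vec.lookup vs i ∈ₜ Vec.lookup ts i
path-incidence (move p t∈ y∈ z∈ _ _) zero    = t∈ , z∈ , y∈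
path-incidence (move p _ _ _ _ _)    (suc i) = path-incidence p i

path-start : {vs : Vec (Fin N) m} {ts : Vec (Triple N) m} →
  Path T x y vs ts → Vec.lookup (y ∷ vs) (fromℕ m) ≡ x
path-start stop               = refl
path-start (move p _ _ _ _ _) = path-start p

-- The path is listed backwards from y, so its last vertex is x. The triple s takes the last index,
-- where `next` wraps around from x to y; `view` singles that index out.
close-path : {vs : Vec (Fin N) m} {ts : Vec (Triple N) m} → Path S x y vs ts →
  (∀ {t} → t ∈ₗ S → t ∈ₗ T) → s ∉ₗ S → s ∈ₗ T → x ∈ₜ s → y ∈ₜ s → x ≢ y → Cycle T
close-path {m = zero} stop _ _ _ _ _ x≢y = ⊥-elim (x≢y refl)
close-path {m = suc m} {S = S} {y = y} {T = T} {s = s} {vs = vs} {ts} p S⊆T s∉S s∈T x∈s y∈s x≢y = record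
  { ℓ        = suc (suc m)
  ; ℓ≥2      = s≤s (s≤s z≤n)
  ; vert     = Vec.lookup (y ∷ vs)
  ; trip     = λ i → index (chosen∈T (view i))
  ; vert-inj = path-vertices-distinct p
  ; trip-inj = λ {i} {j} eq → chosen-injective (view i) (view j)
      (trans (lookup-index (chosen∈T (view i)))
        (trans (cong (lookup T) eq) (sym (lookup-index (chosen∈T (view j))))))
  ; here-in  = λ i → subst (_ ∈ₜ_) (lookup-index (chosen∈T (view i))) (vert∈ (view i))
  ; next-in  = λ i → subst (_ ∈ₜ_) (lookup-index (chosen∈T (view i))) (next∈ (view i))
  }
  where
  chosen : ∀ {i : Fin (suc (suc m))} → View i → Triple _
  chosen ‵fromℕ            = s
  chosen (‵inj₁ {i = i} _) = Vec.lookup ts i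
  chosen∈T : ∀ {i} (v : View i) → chosen v ∈ₗ T
  chosen∈T ‵fromℕ            = s∈T
  chosen∈T (‵inj₁ {i = i} _) = S⊆T (proj₁ (path-incidence p i))
  chosen-injective : ∀ {i j} (v : View i) (w : View j) → chosen v ≡ chosen w → i ≡ j
  chosen-injective ‵fromℕ            ‵fromℕ            eq = refl
  chosen-injective ‵fromℕ            (‵inj₁ {i = j} _) eq =
    ⊥-elim (s∉S (subst (_∈ₗ S) (sym eq) (proj₁ (path-incidence p j))))
  chosen-injective (‵inj₁ {i = i} _) ‵fromℕ            eq =
    ⊥-elim (s∉S (subst (_∈ₗ S) eq (proj₁ (path-incidence p i))))
  chosen-injective (‵inj₁ _)         (‵inj₁ _)         eq = cong inject₁ (path-triples-distinct p eq)
  vert∈ : ∀ {i} (v : View i) → Vec.lookup (y ∷ vs) i ∈ₜ chosen v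
  vert∈ ‵fromℕ            = subst (_∈ₜ s) (sym (path-start p)) x∈s
  vert∈ (‵inj₁ {i = i} _) = proj₁ (proj₂ (path-incidence p i))
  next∈ : ∀ {i} (v : View i) → Vec.lookup (y ∷ vs) (next i) ∈ₜ chosen v
  next∈ ‵fromℕ            = subst (λ i → Vec.lookup (y ∷ vs) i ∈ₜ s) (sym (next-fromℕ (suc m))) y∈s
  next∈ (‵inj₁ {i = i} _) = subst (λ j → Vec.lookup (y ∷ vs) j ∈ₜ Vec.lookup ts i)
                                  (sym (next-inject₁ i)) (proj₂ (proj₂ (path-incidence p i)))

-- Acyclicity in the sense of cycles and of forests

Distinct : Triple N → Set
Distinct (i , j , k) = i ≢ j × i ≢ k × j ≢ k

-- Two vertices of the head joined within the tail would give a simple path that the head closes to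
-- a cycle. The list T is kept fixed as the home of that cycle while S shrinks.
acyclic→forest : (∀ {t} → t ∈ₗ S → t ∈ₗ T) → All Distinct S → Unique S → ¬ Cycle T → Forest S
acyclic→forest S⊆T [] [] acyclic = []
acyclic→forest {S = (i , j , k) ∷ S} {T = T} S⊆T ((i≢j , i≢k , j≢k) ∷ distinct) uS@(_ ∷ unique) acyclic =
  (no-conn fst∈ snd∈ i≢j , no-conn fst∈ trd∈ i≢k , no-conn snd∈ trd∈ j≢k)
  ∷ acyclic→forest (S⊆T ∘ there) distinct unique acyclic
  where
  no-conn : x ∈ₜ (i , j , k) → y ∈ₜ (i , j , k) → x ≢ y → ¬ Conn S x y
  no-conn x∈ y∈ x≢y c = let _ , _ , _ , p = conn→path c in
    acyclic (close-path p (S⊆T ∘ there) (Unique[x∷xs]⇒x∉xs uS) (S⊆T (here refl)) x∈ y∈ x≢y)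

-- If a cycle uses the head triple at i₀, the rest of it leads from `next i₀` back to i₀ through the
-- tail and joins two distinct vertices of the head, against `Apart`. Otherwise the whole cycle lies
-- in the tail.
forest→acyclic : Forest S → ¬ Cycle S
forest→acyclic [] C = no-index (trip (first ℓ≥2))
  where
  open Cycle C
  first : ∀ {n} → 2 ≤ n → Fin n
  first (s≤s _) = zero
  no-index : ¬ Fin 0
  no-index ()
forest→acyclic {S = t ∷ S} (apart ∷ forest) C with any? (λ i → Cycle.trip C i ≟ zero)
... | no  none = forest→acyclic forest record
  { ℓ = ℓ ; ℓ≥2 = ℓ≥2 ; vert = vert ; trip = λ i → proj₁ (tail-index i) ; vert-inj = vert-inj
  ; trip-inj = λ {i} {j} eq → trip-inj
      (trans (proj₂ (tail-index i)) (trans (cong suc eq) (sym (proj₂ (tail-index j)))))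
  ; here-in = λ i → subst (λ k → _ ∈ₜ lookup (t ∷ S) k) (proj₂ (tail-index i)) (here-in i)
  ; next-in = λ i → subst (λ k → _ ∈ₜ lookup (t ∷ S) k) (proj₂ (tail-index i)) (next-in i) }
  where
  open Cycle C
  tail-index : ∀ i → ∃[ j ] trip i ≡ suc j
  tail-index i with trip i in eq
  ... | zero  = ⊥-elim (none (i , eq))
  ... | suc j = j , refl
... | yes (i₀ , at-zero) = next≢ ℓ≥2 i₀ (vert-inj (apart≡ apart
        (subst (λ k → _ ∈ₜ lookup (t ∷ S) k) at-zero (next-in i₀))
        (subst (λ k → _ ∈ₜ lookup (t ∷ S) k) at-zero (here-in i₀))
        (around (proj₁ (returns i₀)) (next i₀) (proj₂ (returns i₀)))))
  where
  open Cycle C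
  returns : ∀ {n} (i : Fin n) → ∃[ m ] nexts m (next i) ≡ i
  returns {suc n} i = n , nexts-period i
  edge : ∀ i → i ≢ i₀ → Conn S (vert i) (vert (next i))
  edge i i≢i₀ with trip i in eq | here-in i | next-in i
  ... | zero  | _ | _ = ⊥-elim (i≢i₀ (trip-inj (trans eq (sym at-zero))))
  ... | suc k | p | q = conn-triple (∈-lookup k) p q
  -- The walk halts as soon as it meets i₀, so every step taken has an index other than i₀ and
  -- avoids the head.
  around : ∀ m i → nexts m i ≡ i₀ → Conn S (vert i) (vert i₀)
  around zero    i refl = stop
  around (suc m) i eq with i ≟ i₀
  ... | yes refl = stop
  ... | no  i≢i₀ = conn-trans (edge i i≢i₀) (around m (next i) eq)

forest-unique : Forest S → All Distinct S → Unique S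
forest-unique [] [] = []
forest-unique {S = t ∷ S} ((ij , _) ∷ forest) (_ ∷ distinct) =
  All.tabulate (λ t′∈S eq → ij (conn-triple t′∈S (subst (_ ∈ₜ_) eq fst∈) (subst (_ ∈ₜ_) eq snd∈)))
  ∷ forest-unique forest distinct

-- Edge listings of the triples of a suspension

-- A triple of the suspension is handled as (i , j , u) with ij an edge in either direction
-- and u ∈ U; sorted recovers its increasing listing.
insert : Fin N → Fin N → Fin N → Triple N
insert i j u with u <? i | u <? j
... | yes _ | _     = u , i , j
... | no  _ | yes _ = i , u , j
... | no  _ | no  _ = i , j , u

sorted : Triple N → Triple N
sorted (i , j , u) with i <? j
... | yes _ = insert i j u
... | no  _ = insert j i u

≮∧≢⇒> : ¬ x < y → y ≢ x → y < x
≮∧≢⇒> {x = x} {y} x≮y y≢x with <-cmp x y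
... | tri< x<y _ _ = ⊥-elim (x≮y x<y)
... | tri≈ _ x≡y _ = ⊥-elim (y≢x (sym x≡y))
... | tri> _ _ y<x = y<x

sorted-swap : {i j : Fin N} → i ≢ j → (u : Fin N) → sorted (i , j , u) ≡ sorted (j , i , u)
sorted-swap {i = i} {j} i≢j u with i <? j | j <? i | <-cmp i j
... | yes p | yes q | _           = ⊥-elim (<-asym p q)
... | yes _ | no  _ | _           = refl
... | no  _ | yes _ | _           = refl
... | no ¬p | no ¬q | tri< p _ _ = ⊥-elim (¬p p)
... | no ¬p | no ¬q | tri≈ _ e _ = ⊥-elim (i≢j e)
... | no ¬p | no ¬q | tri> _ _ q = ⊥-elim (¬q q)

_≈ₜ_ : Triple N → Triple N → Set
s ≈ₜ t = ∀ {v} → (v ∈ₜ s → v ∈ₜ t) × (v ∈ₜ t → v ∈ₜ s)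

insert-≈ : (i j u : Fin N) → insert i j u ≈ₜ (i , j , u)
insert-≈ i j u with u <? i | u <? j
... | yes _ | _     = (λ { fst∈ → trd∈ ; snd∈ → fst∈ ; trd∈ → snd∈ })
                    , (λ { fst∈ → snd∈ ; snd∈ → trd∈ ; trd∈ → fst∈ })
... | no  _ | yes _ = (λ { fst∈ → fst∈ ; snd∈ → trd∈ ; trd∈ → snd∈ })
                    , (λ { fst∈ → fst∈ ; snd∈ → trd∈ ; trd∈ → snd∈ })
... | no  _ | no  _ = (λ p → p) , (λ p → p)

swap-≈ : (i j u : Fin N) → (i , j , u) ≈ₜ (j , i , u)
swap-≈ i j u = (λ { fst∈ → snd∈ ; snd∈ → fst∈ ; trd∈ → trd∈ })
             , (λ { fst∈ → snd∈ ; snd∈ → fst∈ ; trd∈ → trd∈ })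

swap′-≈ : (i j u : Fin N) → (i , j , u) ≈ₜ (i , u , j)
swap′-≈ i j u = (λ { fst∈ → fst∈ ; snd∈ → trd∈ ; trd∈ → snd∈ })
              , (λ { fst∈ → fst∈ ; snd∈ → trd∈ ; trd∈ → snd∈ })

sorted-≈ : (t : Triple N) → sorted t ≈ₜ t
sorted-≈ (i , j , u) {v} with i <? j
... | yes _ = insert-≈ i j u
... | no  _ = (λ p → proj₁ (swap-≈ j i u) (proj₁ (insert-≈ j i u) p))
            , (λ p → proj₂ (insert-≈ j i u) (proj₂ (swap-≈ j i u) p))

conn-≈ : Pointwise _≈ₜ_ S T → Conn S x y → Conn T x y
conn-≈ S≈T = conn-bind λ t∈ p q → let s , s∈ , t≈s = match S≈T t∈ in
  conn-triple s∈ (proj₁ t≈s p) (proj₁ t≈s q)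
  where
  match : Pointwise _≈ₜ_ S T → t ∈ₗ S → ∃[ s ] (s ∈ₗ T × t ≈ₜ s)
  match (t≈s ∷ _)  (here refl) = _ , here refl , λ {_} → t≈s
  match (_ ∷ rest) (there t∈)  = let s , s∈ , t≈s = match rest t∈ in s , there s∈ , λ {_} → t≈s

-- `Apart` makes connected vertices of a triple equal, a conclusion that does not depend on how the
-- triple is listed; `Distinct` then refutes it.
forest-≈ : Pointwise _≈ₜ_ T S → All Distinct T → Forest S → Forest T
forest-≈ [] [] [] = []
forest-≈ {T = t ∷ T} {S = s ∷ S} (t≈s ∷ T≈S) ((ij , ik , jk) ∷ distinct) (apart ∷ forest) =
  (separate fst∈ snd∈ ij , separate fst∈ trd∈ ik , separate snd∈ trd∈ jk) ∷ forest-≈ T≈S distinct forest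
  where
  separate : x ∈ₜ t → y ∈ₜ t → x ≢ y → ¬ Conn T x y
  separate x∈ y∈ x≢y c = x≢y (apart≡ apart (proj₁ t≈s x∈) (proj₁ t≈s y∈) (conn-≈ T≈S c))

map-sorted-≈ : (S : List (Triple N)) → Pointwise _≈ₜ_ (map sorted S) S
map-sorted-≈ []      = []
map-sorted-≈ (t ∷ S) = sorted-≈ t ∷ map-sorted-≈ S

≈-map-sorted : (S : List (Triple N)) → Pointwise _≈ₜ_ S (map sorted S)
≈-map-sorted []      = []
≈-map-sorted (t ∷ S) = (proj₂ (sorted-≈ t) , proj₁ (sorted-≈ t)) ∷ ≈-map-sorted S

-- 3-cycles and orientations relative to edge listings

record IsCyc3 (τ : Fin N → Fin N) (i j k : Fin N) : Set where
  constructor isCyc3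
  field
    map₁ : τ i ≡ j
    map₂ : τ j ≡ k
    map₃ : τ k ≡ i
    fix  : ∀ {v} → ¬ v ∈ₜ (i , j , k) → τ v ≡ v

rotate : ∀ {τ : Fin N → Fin N} {i j k} → IsCyc3 τ i j k → IsCyc3 τ j k i
rotate (isCyc3 p q r f) = isCyc3 q r p λ v∉ → f λ { fst∈ → v∉ trd∈ ; snd∈ → v∉ fst∈ ; trd∈ → v∉ snd∈ }

cyc3-is : {i j k : Fin N} → Distinct (i , j , k) → IsCyc3 (cyc3 i j k) i j k
cyc3-is {i = i} {j} {k} (i≢j , i≢k , j≢k) = isCyc3 at-i at-j at-k elsewhere
  where
  at-i : cyc3 i j k i ≡ j
  at-i rewrite dec-true (i ≟ i) refl = refl
  at-j : cyc3 i j k j ≡ k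
  at-j rewrite dec-false (j ≟ i) (≢-sym i≢j) | dec-true (j ≟ j) refl = refl
  at-k : cyc3 i j k k ≡ i
  at-k rewrite dec-false (k ≟ i) (≢-sym i≢k) | dec-false (k ≟ j) (≢-sym j≢k) | dec-true (k ≟ k) refl = refl
  elsewhere : ∀ {v} → ¬ v ∈ₜ (i , j , k) → cyc3 i j k v ≡ v
  elsewhere {v} v∉ rewrite dec-false (v ≟ i) (λ p → v∉ (inj₁ p)) | dec-false (v ≟ j) (λ p → v∉ (inj₂ (inj₁ p)))
                         | dec-false (v ≟ k) (λ p → v∉ (inj₂ (inj₂ p))) = refl

-- The choice of ω reread along (i , j , u): true when the 3-cycle runs i, j, u. The raw bit depends
-- on where u falls in the linear order, so it could not be compared between different apexes.
orient : Orientation N → Triple N → Bool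
orient ω (i , j , u) = does (σ (sorted (i , j , u)) ω i ≟ j)

Oriented : Bool → (Fin N → Fin N) → Triple N → Set
Oriented true  τ (i , j , u) = IsCyc3 τ i j u
Oriented false τ (i , j , u) = IsCyc3 τ j i u

distinct-swap : {i j u : Fin N} → Distinct (i , j , u) → Distinct (j , i , u)
distinct-swap (ij , iu , ju) = ≢-sym ij , ju , iu

σ-insert : (ω : Orientation N) {i j u : Fin N} → Distinct (i , j , u) →
  ∃[ b ] Oriented b (σ (insert i j u) ω) (i , j , u)
σ-insert ω {i} {j} {u} d@(ij , iu , ju) with u <? i | u <? j
... | yes _ | _ with ω (u , i , j)
...   | true  = true  , rotate (cyc3-is (≢-sym iu , ≢-sym ju , ij))
...   | false = false , rotate (rotate (cyc3-is (iu , ij , ≢-sym ju)))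
σ-insert ω {i} {j} {u} d@(ij , iu , ju) | no _ | yes _ with ω (i , u , j)
-- Placing u in the middle is an odd rearrangement of (i , j , u), so the bit is negated here.
...   | true  = false , rotate (rotate (cyc3-is (iu , ij , ≢-sym ju)))
...   | false = true  , rotate (cyc3-is (≢-sym iu , ≢-sym ju , ij))
σ-insert ω {i} {j} {u} d@(ij , iu , ju) | no _ | no _ with ω (i , j , u)
...   | true  = true  , cyc3-is d
...   | false = false , cyc3-is (distinct-swap d)

σ-sorted : (ω : Orientation N) (t : Triple N) → Distinct t → ∃[ b ] Oriented b (σ (sorted t) ω) t
σ-sorted ω (i , j , u) d with i <? j
... | yes _ = σ-insert ω d
... | no  _ with σ-insert ω (distinct-swap d)
...   | true  , c = false , c
...   | false , c = true  , c

oriented : (ω : Orientation N) (t : Triple N) → Distinct t → Oriented (orient ω t) (σ (sorted t) ω) t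
oriented ω t@(i , j , u) d@(_ , _ , j≢u) with σ-sorted ω t d
... | true  , c rewrite dec-true (σ (sorted t) ω i ≟ j) (IsCyc3.map₁ c) = c
... | false , c rewrite dec-false (σ (sorted t) ω i ≟ j) (λ e → j≢u (trans (sym e) (IsCyc3.map₂ c))) = c

-- Triples of the suspension and their edge listings

module _ {U : Subset N} {E : Fin N → Fin N → Set} (G : IsGraphOff U E) where
  open IsGraphOff G renaming (sym to E-sym)

  Valid : Triple N → Set
  Valid (i , j , u) = E i j × u ∈ᵤ U

  edge≢ : ∀ {i j} → E i j → i ≢ j
  edge≢ e refl = irrefl e

  apex≢ : ∀ {i j u} → E i j → u ∈ᵤ U → i ≢ u
  apex≢ e u∈ refl = avoidsU e u∈

  valid-distinct : Valid t → Distinct t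
  valid-distinct (e , u∈) = edge≢ e , apex≢ e u∈ , apex≢ (E-sym e) u∈

  insert-susp : ∀ {i j u} → i < j → Valid (i , j , u) → IsSuspTriple U E (insert i j u)
  insert-susp {i} {j} {u} i<j v@(e , u∈) with u <? i | u <? j | valid-distinct v
  ... | yes u<i | _       | _ = (u<i , i<j) , inj₁ (u∈ , e)
  ... | no  u≮i | yes u<j | _ , i≢u , _ = (≮∧≢⇒> u≮i i≢u , u<j) , inj₂ (inj₁ (u∈ , e))
  ... | no  u≮i | no  u≮j | _ , _ , j≢u = (i<j , ≮∧≢⇒> u≮j j≢u) , inj₂ (inj₂ (u∈ , e))

  sorted-susp : Valid t → IsSuspTriple U E (sorted t)
  sorted-susp {i , j , u} (e , u∈) with i <? j
  ... | yes i<j = insert-susp i<j (e , u∈)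
  ... | no  i≮j = insert-susp (≮∧≢⇒> i≮j (≢-sym (edge≢ e))) (E-sym e , u∈)

  unsort : IsSuspTriple U E t → ∃[ s ] (Valid s × t ≡ sorted s)
  unsort {a , b , c} ((a<b , b<c) , inj₁ (a∈ , e)) = (b , c , a) , (e , a∈) , eq
    where
    eq : (a , b , c) ≡ sorted (b , c , a)
    eq with b <? c
    ... | no b≮c = ⊥-elim (b≮c b<c)
    ... | yes _ with a <? b | a <? c
    ...   | yes _  | _ = refl
    ...   | no a≮b | _ = ⊥-elim (a≮b a<b)
  unsort {a , b , c} ((a<b , b<c) , inj₂ (inj₁ (b∈ , e))) = (a , c , b) , (e , b∈) , eq
    where
    eq : (a , b , c) ≡ sorted (a , c , b)
    eq with a <? c
    ... | no a≮c = ⊥-elim (a≮c (<-trans a<b b<c))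
    ... | yes _ with b <? a | b <? c
    ...   | yes b<a | _      = ⊥-elim (<-asym a<b b<a)
    ...   | no _    | yes _  = refl
    ...   | no _    | no b≮c = ⊥-elim (b≮c b<c)
  unsort {a , b , c} ((a<b , b<c) , inj₂ (inj₂ (c∈ , e))) = (a , b , c) , (e , c∈) , eq
    where
    eq : (a , b , c) ≡ sorted (a , b , c)
    eq with a <? b
    ... | no a≮b = ⊥-elim (a≮b a<b)
    ... | yes _ with c <? a | c <? b
    ...   | yes c<a | _       = ⊥-elim (<-asym (<-trans a<b b<c) c<a)
    ...   | no _    | yes c<b = ⊥-elim (<-asym b<c c<b)
    ...   | no _    | no _    = refl

-- Cycles of the product of the 3-cycles of a forest

-- The end point is left off the list, so that segments concatenate and a closed orbit is a segment
-- with equal ends.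
data Orb {N} (p : Fin N → Fin N) : Fin N → List (Fin N) → Fin N → Set where
  []   : Orb p x [] x
  step : p x ≡ y → Orb p y w z → Orb p x (x ∷ w) z

orb-++ : Orb p x w y → Orb p y w′ z → Orb p x (w ++ w′) z
orb-++ []         o′ = o′
orb-++ (step e o) o′ = step e (orb-++ o o′)

orb-split : Orb p x w z → y ∈ₗ w →
  ∃[ α ] ∃[ β ] (w ≡ α ++ β × Orb p x α y × Orb p y β z)
orb-split o@(step _ _) (here refl) = [] , _ , refl , [] , o
orb-split (step e o)   (there y∈)  with orb-split o y∈
... | α , β , refl , o₁ , o₂ = _ ∷ α , β , refl , step e o₁ , o₂

-- Every arrival inside the segment is fixed by τ, so composing with τ alters only the final
-- arrival.
orb-∘ : Orb ρ x (y ∷ w) z → (∀ {v} → v ∈ₗ w → τ v ≡ v) → Orb (τ ∘ ρ) x (y ∷ w) (τ z)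
orb-∘ {τ = τ} (step e [])               fixed = step (cong τ e) []
orb-∘ {τ = τ} (step e o@(step _ _)) fixed =
  step (trans (cong τ e) (fixed (here refl))) (orb-∘ o (fixed ∘ there))

-- The p-orbit of v, listed along p from v on, makes up the component of v in S.
record Word {N} (S : List (Triple N)) (p : Fin N → Fin N) (v : Fin N) (w : List (Fin N)) : Set where
  field
    orb      : Orb p v w v
    is-odd   : odd w ≡ true
    unique   : Unique w
    sound    : u ∈ₗ w → Conn S v u
    complete : Conn S v u → u ∈ₗ w

open Word

-- A cycle may be read from any of its members: the list is rotated, which changes neither its
-- length nor the component.
turn : Word S p v w → u ∈ₗ w → ∃ (Word S p u)
turn {p = p} {v = v} {u = u} W u∈w with orb-split (orb W) u∈w
... | α , β , refl , o₁ , o₂ = β ++ α , record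
  { orb      = orb-++ o₂ o₁
  ; is-odd   = trans (odd-++ β α) (trans (xor-comm (odd β) (odd α)) (trans (sym (odd-++ α β)) (is-odd W)))
  ; unique   = Perm.Unique-resp-↭ (setoid _) (Perm.++-comm (setoid _) α β) (unique W)
  ; sound    = λ x∈ → conn-trans (conn-sym (sound W u∈w))
                        (sound W ([ ∈-++⁺ʳ α , ∈-++⁺ˡ ]′ (∈-++⁻ β x∈)))
  ; complete = λ c → [ ∈-++⁺ʳ β , ∈-++⁺ˡ ]′ (∈-++⁻ α (complete W (conn-trans (sound W u∈w) c)))
  }

words-disjoint : Word S p u w → Word S p v w′ → ¬ Conn S u v → Disjoint w w′
words-disjoint W W′ ¬c (p , q) = ¬c (conn-trans (sound W p) (conn-sym (sound W′ q)))

module _ {i j k : Fin N} {t : Triple N} (cyc : IsCyc3 τ i j k) (t≈ : t ≈ₜ (i , j , k))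
         (apart : Apart S (i , j , k)) where
  open IsCyc3 cyc

  -- By apartness the component of v meets the triple in v alone, so τ acts only on the return to v
  -- and redirects it to τ v.
  relink : Word S ρ v w → v ∈ₜ (i , j , k) → Orb (τ ∘ ρ) v w (τ v)
  relink {w = []}    W v∈ with complete W stop
  ... | ()
  relink {w = x ∷ w} W v∈ with orb W
  ... | o@(step _ _) = orb-∘ o λ u∈w → fix λ u∈t →
    Unique[x∷xs]⇒x∉xs (unique W)
      (subst (_∈ₗ w) (sym (apart≡ apart v∈ u∈t (sound W (there u∈w)))) u∈w)

  keep : Word S ρ v w → (∀ {m} → m ∈ₜ (i , j , k) → ¬ Conn S v m) → Word (t ∷ S) (τ ∘ ρ) v w
  keep {v = v} W away = record
    { orb      = orb′ (orb W) (complete W stop) (unmoved ∘ sound W)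
    ; is-odd   = is-odd W
    ; unique   = unique W
    ; sound    = conn-there ∘ sound W
    ; complete = complete W ∘ within
    }
    where
    unmoved : ∀ {u} → Conn S v u → τ u ≡ u
    unmoved c = fix λ u∈ → away u∈ c
    orb′ : ∀ {w} → Orb ρ v w v → v ∈ₗ w → (∀ {u} → u ∈ₗ w → τ u ≡ u) → Orb (τ ∘ ρ) v w v
    orb′ o@(step _ _) v∈w still = subst (Orb _ v _) (still v∈w) (orb-∘ o (still ∘ there))
    within : ∀ {u} → Conn (t ∷ S) v u → Conn S v u
    within c with conn-split c
    ... | inj₁ d = d
    ... | inj₂ (_ , _ , m∈ , _ , d , _) = ⊥-elim (away (proj₁ t≈ m∈) d)

  -- Each old orbit, opened at its vertex of the triple, now ends at the next vertex of the 3-cycle;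
  -- the three chain up in the order i, j, k. Three odd lengths add up to an odd one.
  merge : ∀ {wᵢ wⱼ wₖ} → Word S ρ i wᵢ → Word S ρ j wⱼ → Word S ρ k wₖ →
          Word (t ∷ S) (τ ∘ ρ) i (wᵢ ++ wⱼ ++ wₖ)
  merge {wᵢ = wᵢ} {wⱼ} {wₖ} Wᵢ Wⱼ Wₖ = record
    { orb      = orb-++ (subst (Orb _ i wᵢ) map₁ (relink Wᵢ fst∈))
                   (orb-++ (subst (Orb _ j wⱼ) map₂ (relink Wⱼ snd∈))
                           (subst (Orb _ k wₖ) map₃ (relink Wₖ trd∈)))
    ; is-odd   = trans (odd-++ wᵢ _) (cong₂ _xor_ (is-odd Wᵢ)
                   (trans (odd-++ wⱼ _) (cong₂ _xor_ (is-odd Wⱼ) (is-odd Wₖ))))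
    ; unique   = ++⁺ (unique Wᵢ) (++⁺ (unique Wⱼ) (unique Wₖ) (words-disjoint Wⱼ Wₖ (proj₂ (proj₂ apart))))
                   λ (p , q) → [ (λ q → words-disjoint Wᵢ Wⱼ (proj₁ apart) (p , q))
                               , (λ q → words-disjoint Wᵢ Wₖ (proj₁ (proj₂ apart)) (p , q)) ]′ (∈-++⁻ wⱼ q)
    ; sound    = λ x∈ → [ (λ q → via fst∈ (sound Wᵢ q))
                        , (λ q → [ (λ q → via snd∈ (sound Wⱼ q)) , (λ q → via trd∈ (sound Wₖ q)) ]′ (∈-++⁻ wⱼ q))
                        ]′ (∈-++⁻ wᵢ x∈)
    ; complete = found ∘ conn-split
    }
    where
    via : ∀ {m u} → m ∈ₜ (i , j , k) → Conn S m u → Conn (t ∷ S) i u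
    via m∈ c = conn-trans (conn-triple (here refl) (proj₂ t≈ fst∈) (proj₂ t≈ m∈)) (conn-there c)
    block : ∀ {m u} → m ∈ₜ (i , j , k) → Conn S m u → u ∈ₗ (wᵢ ++ wⱼ ++ wₖ)
    block fst∈ c = ∈-++⁺ˡ (complete Wᵢ c)
    block snd∈ c = ∈-++⁺ʳ wᵢ (∈-++⁺ˡ (complete Wⱼ c))
    block trd∈ c = ∈-++⁺ʳ wᵢ (∈-++⁺ʳ wⱼ (complete Wₖ c))
    found : ∀ {u} → Conn S i u ⊎ (∃[ a ] ∃[ b ] (a ∈ₜ t × b ∈ₜ t × Conn S i a × Conn S b u)) →
            u ∈ₗ (wᵢ ++ wⱼ ++ wₖ)
    found (inj₁ c)                       = block fst∈ c
    found (inj₂ (_ , _ , _ , b∈ , _ , c)) = block (proj₁ t≈ b∈) c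

  -- Whether v is connected to the triple is decided by searching the merged list, whose blocks are
  -- complete components of S.
  extend-words : (∀ v → ∃ (Word S ρ v)) → ∀ v → ∃ (Word (t ∷ S) (τ ∘ ρ) v)
  extend-words W v with ListMembership._∈?_ _≟_ v (proj₁ (W i) ++ proj₁ (W j) ++ proj₁ (W k))
  ... | yes v∈ = turn (merge (proj₂ (W i)) (proj₂ (W j)) (proj₂ (W k))) v∈
  ... | no  v∉ = _ , keep (proj₂ (W v)) (away v∉)
    where
    away : ∀ {v m} → ¬ v ∈ₗ (proj₁ (W i) ++ proj₁ (W j) ++ proj₁ (W k)) →
           m ∈ₜ (i , j , k) → ¬ Conn S v m
    away v∉ fst∈ c = v∉ (∈-++⁺ˡ (complete (proj₂ (W i)) (conn-sym c)))
    away v∉ snd∈ c = v∉ (∈-++⁺ʳ (proj₁ (W i)) (∈-++⁺ˡ (complete (proj₂ (W j)) (conn-sym c))))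
    away v∉ trd∈ c = v∉ (∈-++⁺ʳ (proj₁ (W i)) (∈-++⁺ʳ (proj₁ (W j)) (complete (proj₂ (W k)) (conn-sym c))))

apart-swap : {i j k : Fin N} → Apart S (i , j , k) → Apart S (j , i , k)
apart-swap (ij , ik , jk) = (ij ∘ conn-sym) , jk , ik

keep-oriented : (ω : Orientation N) → Distinct t → Apart S t → Word S ρ v w →
  (∀ {m} → m ∈ₜ t → ¬ Conn S v m) → Word (t ∷ S) (σ (sorted t) ω ∘ ρ) v w
keep-oriented {t = t@(i , j , u)} ω d apart W away with orient ω t | oriented ω t d
... | true  | c = keep c (λ {_} → id , id) apart W away
... | false | c = keep c (swap-≈ i j u) (apart-swap apart) W (away ∘ proj₁ (swap-≈ j i u))

words : (ω : Orientation N) → Forest S → All Distinct S → ∀ v → ∃ (Word S (prodσ (map sorted S) ω) v)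
words ω [] [] v = [ v ] , record
  { orb      = step refl []
  ; is-odd   = refl
  ; unique   = [] ∷ []
  ; sound    = λ { (here refl) → stop }
  ; complete = λ { stop → here refl }
  }
words {S = t@(i , j , u) ∷ S} ω (apart ∷ forest) (d ∷ distinct) with orient ω t | oriented ω t d
... | true  | c = extend-words c (λ {_} → id , id) apart (words ω forest distinct)
... | false | c = extend-words c (swap-≈ i j u) (apart-swap apart) (words ω forest distinct)

-- Reading an N-cycle and its sign off a word

lookup-injective : {A : Set} {w : List A} → Unique w → Injective _≡_ _≡_ (lookup w)
lookup-injective {w = x ∷ w} u       {zero}  {zero}  eq = refl
lookup-injective {w = x ∷ w} u       {zero}  {suc j} eq =
  ⊥-elim (Unique[x∷xs]⇒x∉xs u (subst (_∈ₗ w) (sym eq) (∈-lookup j)))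
lookup-injective {w = x ∷ w} u       {suc i} {zero}  eq =
  ⊥-elim (Unique[x∷xs]⇒x∉xs u (subst (_∈ₗ w) eq (∈-lookup i)))
lookup-injective {w = x ∷ w} (_ ∷ u) {suc i} {suc j} eq = cong suc (lookup-injective u eq)

enumeration-length : {w : List (Fin N)} → Unique w → (∀ v → v ∈ₗ w) → length w ≡ N
enumeration-length {w = w} u all = ≤-antisym (injective⇒≤ (lookup-injective u))
  (injective⇒≤ {f = index ∘ all} λ {a} {b} eq →
    trans (lookup-index (all a)) (trans (cong (lookup w) eq) (sym (lookup-index (all b)))))

orb-lookup-suc : Orb p x (y ∷ w) z → ∀ j → p (lookup (y ∷ w) (inject₁ j)) ≡ lookup w j
orb-lookup-suc (step e (step _ _))   zero    = e
orb-lookup-suc (step _ o@(step _ _)) (suc j) = orb-lookup-suc o j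

orb-lookup-last : Orb p x (y ∷ w) z → p (lookup (y ∷ w) (fromℕ (length w))) ≡ z
orb-lookup-last (step e [])               = e
orb-lookup-last (step _ o@(step _ _)) = orb-lookup-last o

orb-lookup : Orb p v w v → ∀ i → p (lookup w i) ≡ lookup w (next i)
orb-lookup {p = p} {v = v} {w = v ∷ w} o@(step _ _) i with view i
... | ‵fromℕ     = trans (orb-lookup-last o) (cong (lookup (v ∷ w)) (sym (next-fromℕ (length w))))
... | ‵inject₁ j = trans (orb-lookup-suc o j) (cong (lookup (v ∷ w)) (sym (next-inject₁ j)))

-- In a connected S the word lists all vertices, so `lookup` on it is an s as `IsCycleOf` demands.
word-cycle : Word S p v w → (∀ u → Conn S v u) → ∃[ s ] (IsCycleOf p s × sgn s ≡ toBit (par w))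
word-cycle {p = p} {w = w} W connected =
  index-by (enumeration-length (unique W) (complete W ∘ connected))
  where
  -- The domain size is generalised to n because N also occurs in the type of the entries and could
  -- not be replaced by `length w`.
  index-by : ∀ {n} → length w ≡ n →
    ∃[ s ] ((Injective _≡_ _≡_ s × (∀ (i : Fin n) → p (s i) ≡ s (next i))) × inv s % 2 ≡ toBit (par w))
  index-by refl = lookup w , (lookup-injective (unique W) , orb-lookup (orb W)) , inv-parity w

-- Exchanging two apexes

reach : ∀ {x y : Fin N} → Conn T x y → x ≡ y ⊎ Reach T x y
reach stop = inj₁ refl
reach (move c t∈ p q) with reach c
... | inj₁ refl = inj₂ (one t∈ p q)
... | inj₂ r    = inj₂ (step r t∈ p q)

reach→conn : ∀ {x y : Fin N} → Reach T x y → Conn T x y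
reach→conn (one t∈ p q)    = conn-triple t∈ p q
reach→conn (step r t∈ p q) = move (reach→conn r) t∈ p q

reach-source : ∀ {x y : Fin N} → Reach T x y → ∃[ t ] (t ∈ₗ T × x ∈ₜ t)
reach-source (one t∈ p _)   = _ , t∈ , p
reach-source (step r _ _ _) = reach-source r

-- Exchanging the apexes x and y of the triples abx and bcy: the component of x or y merely
-- gets attached elsewhere to the component of b.
forest-exchange : ∀ {a b c x y : Fin N} →
  Forest ((a , b , x) ∷ (b , c , y) ∷ R) → Forest ((a , b , y) ∷ (b , c , x) ∷ R)
forest-exchange {R = R} {a} {b} {c} {x} {y} ((ab , ax , bx) ∷ (bc , by , cy) ∷ forest) =
  (ab′ , ay′ , by′) ∷ (bc , bx ∘ conn-there , cx) ∷ forest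
  where
  cx : ¬ Conn R c x
  cx p = bx (conn-trans (conn-triple (here refl) fst∈ snd∈) (conn-there p))
  from-a : ∀ {u} → u ∈ₜ (b , c , x) → ¬ Conn R a u
  from-a fst∈ p = ab (conn-there p)
  from-a snd∈ p = ab (move (conn-there p) (here refl) snd∈ fst∈)
  from-a trd∈ p = ax (conn-there p)
  ab′ : ¬ Conn ((b , c , x) ∷ R) a b
  ab′ p with conn-split p
  ... | inj₁ q = from-a fst∈ q
  ... | inj₂ (_ , _ , u∈ , _ , q , _) = from-a u∈ q
  ay′ : ¬ Conn ((b , c , x) ∷ R) a y
  ay′ p with conn-split p
  ... | inj₁ q = ab (move (conn-there q) (here refl) trd∈ fst∈)
  ... | inj₂ (_ , _ , u∈ , _ , q , _) = from-a u∈ q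
  to-y : ∀ {u} → u ∈ₜ (b , c , x) → ¬ Conn R u y
  to-y fst∈ p = by p
  to-y snd∈ p = cy p
  to-y trd∈ p = bx (conn-trans (conn-triple (here refl) fst∈ trd∈) (conn-sym (conn-there p)))
  by′ : ¬ Conn ((b , c , x) ∷ R) b y
  by′ p with conn-split p
  ... | inj₁ q = by q
  ... | inj₂ (_ , _ , _ , v∈ , _ , q) = to-y v∈ q

-- Before and after the exchange, the two leading triples join b to each of a, c, x and y.
conn-exchange : ∀ {a b c x y u v : Fin N} →
  Conn ((a , b , x) ∷ (b , c , y) ∷ R) u v → Conn ((a , b , y) ∷ (b , c , x) ∷ R) u v
conn-exchange {R = R} {a} {b} {c} {x} {y} = conn-bind exchanged
  where
  from-b₁ : ∀ {u} → u ∈ₜ (a , b , x) → Conn ((a , b , y) ∷ (b , c , x) ∷ R) b u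
  from-b₁ fst∈ = conn-triple (here refl) snd∈ fst∈
  from-b₁ snd∈ = stop
  from-b₁ trd∈ = conn-triple (there (here refl)) fst∈ trd∈
  from-b₂ : ∀ {u} → u ∈ₜ (b , c , y) → Conn ((a , b , y) ∷ (b , c , x) ∷ R) b u
  from-b₂ fst∈ = stop
  from-b₂ snd∈ = conn-triple (there (here refl)) fst∈ snd∈
  from-b₂ trd∈ = conn-triple (here refl) snd∈ trd∈
  exchanged : ∀ {t u v} → t ∈ₗ ((a , b , x) ∷ (b , c , y) ∷ R) → u ∈ₜ t → v ∈ₜ t →
              Conn ((a , b , y) ∷ (b , c , x) ∷ R) u v
  exchanged (here refl)         p q = conn-trans (conn-sym (from-b₁ p)) (from-b₁ q)
  exchanged (there (here refl)) p q = conn-trans (conn-sym (from-b₂ p)) (from-b₂ q)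
  exchanged (there (there t∈))  p q = conn-triple (there (there t∈)) p q

-- The word of a forest led by abx and bcy

module _ (ω : Orientation N) {R : List (Triple N)} {a b c : Fin N} {A B C : List (Fin N)} where
  prodR : Fin N → Fin N
  prodR = prodσ (map sorted R) ω

  par-blocks : ∀ {x X y Y} → Word R prodR b B → Word R prodR c C → Word R prodR x X → Word R prodR y Y →
    ¬ Conn R x y → par (A ++ (B ++ C ++ X) ++ Y) ≡ not (par (A ++ (B ++ C ++ Y) ++ X))
  par-blocks {X = X} {Y = Y} WB WC WX WY xy =
    trans (cong par (regroup X Y))
      (trans (par-swap (A ++ B ++ C) X Y [] (is-odd WX) (is-odd WY) (words-disjoint WX WY xy))
             (cong (not ∘ par) (sym (regroup Y X))))
    where
    regroup : ∀ X Y → A ++ (B ++ C ++ X) ++ Y ≡ (A ++ B ++ C) ++ (X ++ Y) ++ []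
    regroup X Y = begin
      A ++ (B ++ C ++ X) ++ Y         ≡⟨ cong (A ++_) (++-assoc B (C ++ X) Y) ⟩
      A ++ B ++ (C ++ X) ++ Y         ≡⟨ cong (λ z → A ++ B ++ z) (++-assoc C X Y) ⟩
      A ++ B ++ C ++ X ++ Y           ≡⟨ cong (A ++_) (++-assoc B C (X ++ Y)) ⟨
      A ++ (B ++ C) ++ X ++ Y         ≡⟨ ++-assoc A (B ++ C) (X ++ Y) ⟨
      (A ++ B ++ C) ++ X ++ Y         ≡⟨ cong ((A ++ B ++ C) ++_) (++-identityʳ (X ++ Y)) ⟨
      (A ++ B ++ C) ++ (X ++ Y) ++ [] ∎
      where open ≡-Reasoning

  -- A reversed bcy makes the orbit visit b, y, c, so Y and C trade places. The parity is stated
  -- inside a context A, X because the word becomes the middle block of the word read from a.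
  word-bcy : ∀ {y Y} → Word R prodR b B → Word R prodR c C → Word R prodR y Y →
    Apart R (b , c , y) → Distinct (b , c , y) →
    ∃[ D ] (Word ((b , c , y) ∷ R) (σ (sorted (b , c , y)) ω ∘ prodR) b (B ++ D) ×
            (∀ X → par (A ++ (B ++ D) ++ X) ≡ not (orient ω (b , c , y)) xor par (A ++ (B ++ C ++ Y) ++ X)))
  word-bcy {y} {Y} WB WC WY apart@(bc , by , cy) d with orient ω (b , c , y) | oriented ω (b , c , y) d
  ... | true  | cyc = C ++ Y , merge cyc (λ {_} → id , id) apart WB WC WY , λ X → refl
  ... | false | cyc = Y ++ C , merge (rotate cyc) (swap′-≈ b c y) (by , bc , cy ∘ conn-sym) WB WY WC , λ X →
    trans (cong par (regroup (Y ++ C) X))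
      (trans (par-swap (A ++ B) Y C X (is-odd WY) (is-odd WC) (words-disjoint WY WC (cy ∘ conn-sym)))
             (cong (not ∘ par) (sym (regroup (C ++ Y) X))))
    where
    regroup : ∀ D X → A ++ (B ++ D) ++ X ≡ (A ++ B) ++ D ++ X
    regroup D X = trans (cong (A ++_) (++-assoc B D X)) (sym (++-assoc A B (D ++ X)))

  -- The reference order A B C Y X belongs to both triples oriented along their listings. A reversed
  -- abx moves X in front of the whole component of b, again two odd blocks trading places.
  word-abx-bcy : ∀ {x X y Y} →
    Word R prodR a A → Word R prodR b B → Word R prodR c C → Word R prodR x X → Word R prodR y Y →
    Forest ((a , b , x) ∷ (b , c , y) ∷ R) → Distinct (a , b , x) → Distinct (b , c , y) →
    ∃[ w ] (Word ((a , b , x) ∷ (b , c , y) ∷ R)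
                 (prodσ (map sorted ((a , b , x) ∷ (b , c , y) ∷ R)) ω) a w ×
            par w ≡ (not (orient ω (a , b , x)) xor not (orient ω (b , c , y)))
                    xor par (A ++ (B ++ C ++ Y) ++ X))
  word-abx-bcy {x} {X} {y} {Y} WA WB WC WX WY (apart₁@(ab , ax , bx) ∷ apart₂ ∷ _) d₁ d₂ =
    joined (word-bcy WB WC WY apart₂ d₂)
           -- The orbits of a and x survive the factor of bcy: if either met that triple, a or x
           -- would already be connected to b.
           (keep-oriented ω d₂ apart₂ WA λ m∈ p → ab (to-b m∈ p))
           (keep-oriented ω d₂ apart₂ WX λ m∈ p → bx (conn-sym (to-b m∈ p)))
    where
    to-b : ∀ {v m} → m ∈ₜ (b , c , y) → Conn R v m → Conn ((b , c , y) ∷ R) v b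
    to-b m∈ p = move (conn-there p) (here refl) m∈ fst∈
    S₂ : List (Triple N)
    S₂ = (b , c , y) ∷ R
    p₂ : Fin N → Fin N
    p₂ = σ (sorted (b , c , y)) ω ∘ prodR
    joined : ∃[ D ] (Word S₂ p₂ b (B ++ D) ×
               (∀ X → par (A ++ (B ++ D) ++ X) ≡ not (orient ω (b , c , y)) xor par (A ++ (B ++ C ++ Y) ++ X))) →
             Word S₂ p₂ a A → Word S₂ p₂ x X →
             ∃[ w ] (Word ((a , b , x) ∷ S₂) (σ (sorted (a , b , x)) ω ∘ p₂) a w ×
                     par w ≡ (not (orient ω (a , b , x)) xor not (orient ω (b , c , y)))
                             xor par (A ++ (B ++ C ++ Y) ++ X))
    joined (D , WBD , parity) WA′ WX′ with orient ω (a , b , x) | oriented ω (a , b , x) d₁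
    ... | true  | cyc = _ , merge cyc (λ {_} → id , id) apart₁ WA′ WBD WX′ , parity X
    ... | false | cyc = _ , merge (rotate cyc) (swap′-≈ a b x) (ax , ab , bx ∘ conn-sym) WA′ WX′ WBD ,
      (begin
        par (A ++ X ++ B ++ D)           ≡⟨ cong (λ z → par (A ++ z)) (++-identityʳ (X ++ B ++ D)) ⟨
        par (A ++ (X ++ B ++ D) ++ [])
          ≡⟨ par-swap A X (B ++ D) [] (is-odd WX′) (is-odd WBD) (words-disjoint WX′ WBD (bx ∘ conn-sym)) ⟩
        not (par (A ++ ((B ++ D) ++ X) ++ []))
          ≡⟨ cong (λ z → not (par (A ++ z))) (++-identityʳ ((B ++ D) ++ X)) ⟩
        not (par (A ++ (B ++ D) ++ X))   ≡⟨ cong not (parity X) ⟩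
        not (not (orient ω (b , c , y)) xor par (A ++ (B ++ C ++ Y) ++ X))
          ≡⟨ not-distribˡ-xor (not (orient ω (b , c , y))) _ ⟩
        not (not (orient ω (b , c , y))) xor par (A ++ (B ++ C ++ Y) ++ X) ∎)
      where open ≡-Reasoning

-- Adding the two sides cancels m and the four negations; what remains is the 1 from `not m`.
xor-exchange : ∀ p q r s m → (not p xor not q) xor m ≡ (not r xor not s) xor not m →
               (p xor s) xor (r xor q) ≡ true
xor-exchange p q r s m eq = begin
  (p xor s) xor (r xor q)
    ≡⟨ solve 5 (λ p q r s m → (p :+ s) :+ (r :+ q) :=
         con true :+ ((((con true :+ p) :+ (con true :+ q)) :+ m)
                   :+ (((con true :+ r) :+ (con true :+ s)) :+ (con true :+ m)))) refl p q r s m ⟩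
  not (((not p xor not q) xor m) xor ((not r xor not s) xor not m))
    ≡⟨ cong (λ z → not (z xor ((not r xor not s) xor not m))) eq ⟩
  not (((not r xor not s) xor not m) xor ((not r xor not s) xor not m))
    ≡⟨ cong not (xor-same ((not r xor not s) xor not m)) ⟩
  true ∎
  where
  open ≡-Reasoning

xor-triangle : ∀ p q r → p xor q ≡ true → p xor r ≡ true → r xor q ≡ true → ⊥
xor-triangle true  true  _     () _  _
xor-triangle true  false true  _  () _
xor-triangle true  false false _  _  ()
xor-triangle false true  true  _  _  ()
xor-triangle false true  false _  () _
xor-triangle false false _     () _  _

transpose-left : (i j : Fin N) → transpose i j i ≡ j
transpose-left i j rewrite dec-true (i ≟ i) refl = refl

transpose-right : (i j : Fin N) → transpose i j j ≡ i
transpose-right i j with j ≟ i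
... | yes refl = refl
... | no  _ rewrite dec-true (j ≟ j) refl = refl

transpose-other : {i j k : Fin N} → k ≢ i → k ≢ j → transpose i j k ≡ k
transpose-other {i = i} {j} {k} k≢i k≢j rewrite dec-false (k ≟ i) k≢i | dec-false (k ≟ j) k≢j = refl

∣p∪q∣≤∣p∣+∣q∣ : (p q : Subset m) → ∣ p ∪ q ∣ ≤ ∣ p ∣ + ∣ q ∣
∣p∪q∣≤∣p∣+∣q∣ []            []            = z≤n
∣p∪q∣≤∣p∣+∣q∣ (outside ∷ p) (outside ∷ q) = ∣p∪q∣≤∣p∣+∣q∣ p q
∣p∪q∣≤∣p∣+∣q∣ (outside ∷ p) (inside ∷ q)
  rewrite +-suc ∣ p ∣ ∣ q ∣ = s≤s (∣p∪q∣≤∣p∣+∣q∣ p q)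
∣p∪q∣≤∣p∣+∣q∣ (inside ∷ p)  (outside ∷ q) = s≤s (∣p∪q∣≤∣p∣+∣q∣ p q)
∣p∪q∣≤∣p∣+∣q∣ (inside ∷ p)  (inside ∷ q)  =
  s≤s (ℕₚ.≤-trans (∣p∪q∣≤∣p∣+∣q∣ p q) (ℕₚ.+-monoʳ-≤ ∣ p ∣ (ℕₚ.n≤1+n ∣ q ∣)))

-- Phrased as a refutation, since every use aims at `⊥`. With x and y equal it supplies an element
-- of U different from a given vertex.
third-element : {U : Subset N} → 3 ≤ ∣ U ∣ → (x y : Fin N) → ¬ (∀ z → z ∈ᵤ U → z ≢ x → z ≢ y → ⊥)
third-element {U = U} 3≤ x y none = ℕₚ.<⇒≱ 3≤ (ℕₚ.≤-trans (p⊆q⇒∣p∣≤∣q∣ U⊆) two)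
  where
  U⊆ : ∀ {z} → z ∈ᵤ U → z ∈ᵤ (⁅ x ⁆ ∪ ⁅ y ⁆)
  U⊆ {z} z∈ with z ≟ x | z ≟ y
  ... | yes refl | _        = x∈p∪q⁺ (inj₁ (x∈⁅x⁆ x))
  ... | no _     | yes refl = x∈p∪q⁺ (inj₂ (x∈⁅x⁆ y))
  ... | no z≢x   | no z≢y   = ⊥-elim (none z z∈ z≢x z≢y)
  two : ∣ ⁅ x ⁆ ∪ ⁅ y ⁆ ∣ ≤ 2
  two = subst₂ (λ i j → ∣ ⁅ x ⁆ ∪ ⁅ y ⁆ ∣ ≤ i + j) (∣⁅x⁆∣≡1 x) (∣⁅x⁆∣≡1 y) (∣p∪q∣≤∣p∣+∣q∣ ⁅ x ⁆ ⁅ y ⁆)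

move-to-front : {A : Set} {v : A} {xs : List A} → v ∈ₗ xs →
  ∃[ ys ] Permutation._↭_ (setoid A) xs (v ∷ ys)
move-to-front v∈ with ∈-∃++ v∈
... | ys , zs , refl = ys ++ zs , Perm.↭-shift (setoid _) ys zs

-- Spanning trees of the suspension and permutations of U

module _ {U : Subset N} {E : Fin N → Fin N → Set} (G : IsGraphOff U E) where
  open IsGraphOff G using (avoidsU) renaming (sym to E-sym)

  record Tree (S : List (Triple N)) : Set where
    field
      valid  : All (Valid G) S
      forest : Forest S
      conn   : ∀ u v → Conn S u v

  open Tree

  distinct-all : All (Valid G) S → All Distinct S
  distinct-all = All.map (valid-distinct G)

  sorted-distinct : ∀ {t} → Valid G t → Distinct (sorted t)
  sorted-distinct {t} v with sorted t | sorted-susp G v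
  ... | _ | (a<b , b<c) , _ = <⇒≢ a<b , <⇒≢ (<-trans a<b b<c) , <⇒≢ b<c

  map-sorted-distinct : All (Valid G) S → All Distinct (map sorted S)
  map-sorted-distinct = All.map⁺ ∘ All.map sorted-distinct

  -- The two distinct vertices exclude a one-vertex graph, where the empty list is a `Tree` but
  -- covers nothing.
  tree→spanning : ∀ {x y} → x ≢ y → Tree S → SpanningTree U E (map sorted S)
  tree→spanning {S = S} {x} {y} x≢y tree = record
    { edges     = All.map⁺ (All.map (sorted-susp G) (valid tree))
    ; distinct  = forest-unique forest-sorted distinct-sorted
    ; acyclic   = forest→acyclic forest-sorted
    ; covering  = covered
    ; connected = joined
    }
    where
    distinct-sorted : All Distinct (map sorted S)
    distinct-sorted = map-sorted-distinct (valid tree)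
    forest-sorted : Forest (map sorted S)
    forest-sorted = forest-≈ (map-sorted-≈ S) distinct-sorted (forest tree)
    conn-sorted : ∀ u v → Conn (map sorted S) u v
    conn-sorted u v = conn-≈ (≈-map-sorted S) (conn tree u v)
    covered : ∀ v → ∃[ t ] (t ∈ₗ map sorted S × v ∈ₜ t)
    -- A walk from v to whichever of x and y differs from v must start with a triple containing v.
    covered v with v ≟ x
    ... | no v≢x = [ (λ e → ⊥-elim (v≢x e)) , reach-source ]′ (reach (conn-sorted v x))
    ... | yes refl = [ (λ e → ⊥-elim (x≢y e)) , reach-source ]′ (reach (conn-sorted v y))
    joined : ∀ u v → Reach (map sorted S) u v
    joined u v with reach (conn-sorted u v)
    ... | inj₂ r    = r
    ... | inj₁ refl = let _ , t∈ , u∈ = covered u in one t∈ u∈ u∈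

  unsort-all : All (IsSuspTriple U E) T → ∃[ S ] (All (Valid G) S × T ≡ map sorted S)
  unsort-all [] = [] , [] , refl
  unsort-all (t ∷ ts) with unsort G t | unsort-all ts
  ... | s , v , refl | S , vs , refl = s ∷ S , v ∷ vs , refl

  -- Moving the two triples to the front may change `prodσ`, which is harmless because `Is3Pfaffian`
  -- speaks of every listing.
  spanning→tree : ∀ {s₁ s₂} → SpanningTree U E T → Valid G s₁ → Valid G s₂ →
    sorted s₁ ∈ₗ T → sorted s₂ ∈ₗ T → sorted s₁ ≢ sorted s₂ → ∃[ R ] Tree (s₁ ∷ s₂ ∷ R)
  spanning→tree {T = T} {s₁} {s₂} span v₁ v₂ t₁∈ t₂∈ t₁≢t₂ with move-to-front t₁∈
  ... | T₁ , T↭₁ with Perm.∈-resp-↭ (setoid _) T↭₁ t₂∈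
  ...   | here e = ⊥-elim (t₁≢t₂ (sym e))
  ...   | there t₂∈₁ with move-to-front t₂∈₁
  ...     | T₂ , T↭₂ = reordered (Permutation.↭-trans (setoid _) T↭₁ (Permutation.↭-prep (setoid _) _ T↭₂))
    where
    open SpanningTree span
    reordered : ∀ {T₂} → Permutation._↭_ (setoid _) T (sorted s₁ ∷ sorted s₂ ∷ T₂) →
                ∃[ R ] Tree (s₁ ∷ s₂ ∷ R)
    reordered {T₂} T↭ with unsort-all {T₂} (All.tabulate λ t∈ →
      All.lookup edges (Perm.∈-resp-↭ (setoid _) (Permutation.↭-sym (setoid _) T↭) (there (there t∈))))
    ... | R , vs , refl = R , record
      { valid  = v₁ ∷ v₂ ∷ vs
      ; forest = forest-≈ (≈-map-sorted _) (distinct-all (v₁ ∷ v₂ ∷ vs))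
                   (acyclic→forest (Perm.∈-resp-↭ (setoid _) (Permutation.↭-sym (setoid _) T↭))
                     (map-sorted-distinct (v₁ ∷ v₂ ∷ vs)) (Perm.Unique-resp-↭ (setoid _) T↭ distinct) acyclic)
      ; conn   = λ u v → conn-≈ (map-sorted-≈ _)
                   (conn-bind (conn-triple ∘ Perm.∈-resp-↭ (setoid _) T↭) (reach→conn (connected u v)))
      }

  tree-exchange : ∀ {a b c x y} → Tree ((a , b , x) ∷ (b , c , y) ∷ R) → Tree ((a , b , y) ∷ (b , c , x) ∷ R)
  tree-exchange record { valid = (ab , x∈) ∷ (bc , y∈) ∷ vs ; forest = f ; conn = κ } = record
    { valid  = (ab , y∈) ∷ (bc , x∈) ∷ vs
    ; forest = forest-exchange f
    ; conn   = λ u v → conn-exchange (κ u v)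
    }

  module _ {π π⁻¹ : Fin N → Fin N} (ππ⁻¹ : ∀ v → π (π⁻¹ v) ≡ v) (π⁻¹π : ∀ v → π⁻¹ (π v) ≡ v)
           (keepsU : ∀ {v} → v ∈ᵤ U → π v ∈ᵤ U) (fixes : ∀ {v} → v ∉ᵤ U → π v ≡ v) where

    relabel : Triple N → Triple N
    relabel (i , j , u) = π i , π j , π u

    relabel-∈ : ∀ {v t} → v ∈ₜ t → π v ∈ₜ relabel t
    relabel-∈ fst∈ = fst∈
    relabel-∈ snd∈ = snd∈
    relabel-∈ trd∈ = trd∈

    unlabel-∈ : ∀ {v t} → v ∈ₜ relabel t → π⁻¹ v ∈ₜ t
    unlabel-∈ fst∈ = inj₁ (π⁻¹π _)
    unlabel-∈ snd∈ = inj₂ (inj₁ (π⁻¹π _))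
    unlabel-∈ trd∈ = inj₂ (inj₂ (π⁻¹π _))

    conn-relabel : ∀ {u v} → Conn S u v → Conn (map relabel S) (π u) (π v)
    conn-relabel = conn-map π λ t∈ p q → conn-triple (∈-map⁺ relabel t∈) (relabel-∈ p) (relabel-∈ q)

    conn-unlabel : ∀ {u v} → Conn (map relabel S) (π u) (π v) → Conn S u v
    conn-unlabel {S = S} c = subst₂ (Conn S) (π⁻¹π _) (π⁻¹π _)
      (conn-map π⁻¹ (λ t∈ p q → let t , t∈ , e = ∈-map⁻ relabel t∈ in
        conn-triple t∈ (unlabel-∈ {t = t} (subst (_ ∈ₜ_) e p)) (unlabel-∈ {t = t} (subst (_ ∈ₜ_) e q))) c)

    forest-relabel : Forest S → Forest (map relabel S)
    forest-relabel [] = []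
    forest-relabel ((ij , ik , jk) ∷ f) =
      (ij ∘ conn-unlabel , ik ∘ conn-unlabel , jk ∘ conn-unlabel) ∷ forest-relabel f

    valid-relabel : ∀ {t} → Valid G t → Valid G (relabel t)
    valid-relabel (e , u∈) =
      subst₂ E (sym (fixes (avoidsU e))) (sym (fixes (avoidsU (E-sym e)))) e , keepsU u∈

    tree-relabel : Tree S → Tree (map relabel S)
    tree-relabel {S = S} tree = record
      { valid  = All.map⁺ (All.map valid-relabel (valid tree))
      ; forest = forest-relabel (forest tree)
      ; conn   = λ u v → subst₂ (Conn (map relabel S)) (ππ⁻¹ u) (ππ⁻¹ v)
                           (conn-relabel (conn tree (π⁻¹ u) (π⁻¹ v)))
      }

    -- The vertices a, b, c lie outside U and stay fixed, so only the apexes move; the rest of the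
    -- tree may change arbitrarily.
    tree-relabel-pair : ∀ {a b c x y} → Tree ((a , b , x) ∷ (b , c , y) ∷ R) →
                        ∃[ R′ ] Tree ((a , b , π x) ∷ (b , c , π y) ∷ R′)
    tree-relabel-pair {R = R} {x = x} {y} tree@(record { valid = (ab , _) ∷ (bc , _) ∷ _ }) =
      map relabel R , subst Tree (cong₂ (λ t₁ t₂ → t₁ ∷ t₂ ∷ map relabel R)
        (cong₂ (λ i j → i , j , π x) (fixes (avoidsU ab)) (fixes (avoidsU bc)))
        (cong₂ (λ i j → i , j , π y) (fixes (avoidsU bc)) (fixes (avoidsU (E-sym bc))))) (tree-relabel tree)

  tree-transpose : ∀ {a b c x y} i j → i ∈ᵤ U → j ∈ᵤ U → Tree ((a , b , x) ∷ (b , c , y) ∷ R) →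
    ∃[ R′ ] Tree ((a , b , transpose i j x) ∷ (b , c , transpose i j y) ∷ R′)
  tree-transpose i j i∈ j∈ = tree-relabel-pair {π⁻¹ = transpose j i}
    (λ _ → transpose-inverse i j) (λ _ → transpose-inverse j i)
    keeps λ v∉ → transpose-other (λ { refl → v∉ i∈ }) (λ { refl → v∉ j∈ })
    where
    keeps : ∀ {v} → v ∈ᵤ U → transpose i j v ∈ᵤ U
    keeps {v} v∈ = by-cases (v ≟ i) (v ≟ j)
      where
      by-cases : Dec (v ≡ i) → Dec (v ≡ j) → transpose i j v ∈ᵤ U
      by-cases (yes refl) _          = subst (_∈ᵤ U) (sym (transpose-left i j)) j∈
      by-cases (no _)     (yes refl) = subst (_∈ᵤ U) (sym (transpose-right i j)) i∈
      by-cases (no v≢i)   (no v≢j)   = subst (_∈ᵤ U) (sym (transpose-other v≢i v≢j)) v∈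

  module _ (3≤∣U∣ : 3 ≤ ∣ U ∣) (ω : Orientation N) (pfaffian : Is3Pfaffian U E ω) where

    -- The trees before and after the exchange share R and hence all five blocks. Their reference
    -- orders differ by exchanging X and Y, and `pfaffian` equates the signs, so the four bits of ω
    -- must add up to 1.
    exchange-parity : ∀ {a b c x y} → Tree ((a , b , x) ∷ (b , c , y) ∷ R) →
      (orient ω (a , b , x) xor orient ω (b , c , x)) xor (orient ω (a , b , y) xor orient ω (b , c , y)) ≡ true
    exchange-parity {R = R} {a} {b} {c} {x} {y} tree =
      compare (words ω R-forest (distinct-all R-valid)) (valid tree) (valid tree′) (forest tree) (forest tree′)
      where
      tree′ : Tree ((a , b , y) ∷ (b , c , x) ∷ R)
      tree′ = tree-exchange tree
      R-forest : Forest R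
      R-forest with forest tree
      ... | _ ∷ _ ∷ f = f
      R-valid : All (Valid G) R
      R-valid with valid tree
      ... | _ ∷ _ ∷ vs = vs
      compare : (∀ v → ∃ (Word R (prodσ (map sorted R) ω) v)) →
        All (Valid G) ((a , b , x) ∷ (b , c , y) ∷ R) → All (Valid G) ((a , b , y) ∷ (b , c , x) ∷ R) →
        Forest ((a , b , x) ∷ (b , c , y) ∷ R) → Forest ((a , b , y) ∷ (b , c , x) ∷ R) →
        (orient ω (a , b , x) xor orient ω (b , c , x)) xor (orient ω (a , b , y) xor orient ω (b , c , y)) ≡ true
      compare W (abx ∷ bcy ∷ _) (aby ∷ bcx ∷ _) f@((_ , _ , bx) ∷ _) f′
        with W a | W b | W c | W x | W y
      ... | A , WA | B , WB | C , WC | X , WX | Y , WY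
        with word-abx-bcy ω WA WB WC WX WY f (valid-distinct G abx) (valid-distinct G bcy)
           | word-abx-bcy ω WA WB WC WY WX f′ (valid-distinct G aby) (valid-distinct G bcx)
      ... | w , Ww , parity | w′ , Ww′ , parity′
        with word-cycle Ww (conn tree a) | word-cycle Ww′ (conn tree′ a)
      ... | s , cycle , sign | s′ , cycle′ , sign′ =
        xor-exchange (orient ω (a , b , x)) (orient ω (b , c , y)) (orient ω (a , b , y)) (orient ω (b , c , x)) _
          (trans (sym parity) (trans same (trans parity′ (cong (signs xor_) transposed))))
        where
        signs : Bool
        signs = not (orient ω (a , b , y)) xor not (orient ω (b , c , x))
        -- A link from x to y within R would continue through bcy to b.
        xy : ¬ Conn R x y
        xy q = bx (conn-trans (conn-triple (here refl) fst∈ trd∈) (conn-sym (conn-there q)))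
        transposed : par (A ++ (B ++ C ++ X) ++ Y) ≡ not (par (A ++ (B ++ C ++ Y) ++ X))
        transposed = par-blocks ω {a = a} {A = A} WB WC WX WY xy
        a≢b : a ≢ b
        a≢b = proj₁ (valid-distinct G abx)
        same : par w ≡ par w′
        same = toBit-injective (trans (sym sign)
          (trans (pfaffian _ _ s s′ (tree→spanning a≢b tree) (tree→spanning a≢b tree′) cycle cycle′) sign′))

    -- For a third apex z, transposing U yields trees with apex pairs (x , z) and (z , y) over the
    -- same a, b, c. One function r serves all three trees, and three bits cannot be pairwise
    -- different.
    no-adjacent : ∀ {a b c x y} → SpanningTree U E T → Valid G (a , b , x) → Valid G (b , c , y) →
      sorted (a , b , x) ∈ₗ T → sorted (b , c , y) ∈ₗ T → ¬ x ≢ y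
    no-adjacent {a = a} {b} {c} {x} {y} span abx bcy t₁∈ t₂∈ x≢y =
      third-element 3≤∣U∣ x y λ z z∈ z≢x z≢y →
        let _ , txy = spanning→tree span abx bcy t₁∈ t₂∈ different
            _ , txz = tree-transpose y z (proj₂ bcy) z∈ txy
            _ , tzy = tree-transpose x z (proj₂ abx) z∈ txy
        in xor-triangle (r x) (r y) (r z) (exchange-parity txy)
             (subst₂ (λ u v → r u xor r v ≡ true) (transpose-other x≢y (≢-sym z≢x)) (transpose-left y z)
               (exchange-parity txz))
             (subst₂ (λ u v → r u xor r v ≡ true) (transpose-left x z) (transpose-other (≢-sym x≢y) (≢-sym z≢y))
               (exchange-parity tzy))
      where
      r : Fin N → Bool
      r u = orient ω (a , b , u) xor orient ω (b , c , u)
      not-in : ¬ x ∈ₜ (b , c , y)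
      not-in fst∈ = avoidsU (proj₁ bcy) (proj₂ abx)
      not-in snd∈ = avoidsU (E-sym (proj₁ bcy)) (proj₂ abx)
      not-in trd∈ = x≢y refl
      different : sorted (a , b , x) ≢ sorted (b , c , y)
      different e = not-in (proj₁ (sorted-≈ (b , c , y)) (subst (x ∈ₜ_) e (proj₂ (sorted-≈ (a , b , x)) trd∈)))

    -- With no two triples of different apexes sharing a vertex outside U, all that is
    -- reachable from x ∈ U lies in triples of apex x.
    module _ (span : SpanningTree U E T) where
      open SpanningTree span

      UnderApex : Fin N → Fin N → Set
      UnderApex x v = ∃[ i ] ∃[ j ] (Valid G (i , j , x) × sorted (i , j , x) ∈ₗ T × v ∈ₜ (i , j , x))

      pivot : ∀ {v i j u} → v ∉ᵤ U → Valid G (i , j , u) → sorted (i , j , u) ∈ₗ T → v ∈ₜ (i , j , u) →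
              ∃[ k ] (Valid G (v , k , u) × sorted (v , k , u) ∈ₗ T)
      pivot v∉ val       t∈ fst∈ = _ , val , t∈
      pivot v∉ (e , u∈) t∈ snd∈ =
        _ , (E-sym e , u∈) , subst (_∈ₗ T) (sorted-swap (edge≢ G e) _) t∈
      pivot v∉ (_ , u∈)  t∈ trd∈ = ⊥-elim (v∉ u∈)

      apex-or-base : ∀ {v i j u} → Valid G (i , j , u) → v ∈ₜ (i , j , u) → v ≡ u ⊎ v ∉ᵤ U
      apex-or-base (e , _) fst∈ = inj₂ (avoidsU e)
      apex-or-base (e , _) snd∈ = inj₂ (avoidsU (E-sym e))
      apex-or-base _       trd∈ = inj₁ refl

      -- At a vertex outside U, triples with different apexes can be listed as (k , v , u) and (v ,
      -- k′ , x), which `no-adjacent` excludes; a vertex in U is itself the apex of both.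
      same-apex : ∀ {x v i j u} → UnderApex x v → Valid G (i , j , u) → sorted (i , j , u) ∈ₗ T →
                  v ∈ₜ (i , j , u) → u ≡ x
      same-apex {x} {v} {u = u} (_ , _ , val′ , t′∈ , v∈′) val t∈ v∈ with u ≟ x
      ... | yes u≡x = u≡x
      ... | no u≢x with apex-or-base val v∈ | apex-or-base val′ v∈′
      ...   | inj₁ refl | inj₁ refl = refl
      ...   | inj₁ refl | inj₂ v∉   = ⊥-elim (v∉ (proj₂ val))
      ...   | inj₂ v∉   | inj₁ refl = ⊥-elim (v∉ (proj₂ val′))
      ...   | inj₂ v∉   | inj₂ _ with pivot v∉ val t∈ v∈ | pivot v∉ val′ t′∈ v∈′
      ...     | _ , (e , u∈) , s∈ | _ , val″ , s′∈ = ⊥-elim (no-adjacent span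
              (E-sym e , u∈) val″ (subst (_∈ₗ T) (sorted-swap (edge≢ G e) _) s∈) s′∈ u≢x)

      under-next : ∀ {x t v w} → (v ≡ x × x ∈ᵤ U ⊎ UnderApex x v) → t ∈ₗ T → v ∈ₜ t → w ∈ₜ t → UnderApex x w
      under-next from t∈ v∈ w∈ with unsort G (All.lookup edges t∈)
      under-next (inj₂ under) t∈ v∈ w∈ | s@(i , j , u) , val , refl
        with same-apex under val t∈ (proj₁ (sorted-≈ s) v∈)
      ... | refl = i , j , val , t∈ , proj₁ (sorted-≈ s) w∈
      under-next (inj₁ (refl , x∈)) t∈ v∈ w∈ | s@(i , j , u) , val , refl
        with apex-or-base val (proj₁ (sorted-≈ s) v∈)
      ... | inj₁ refl = i , j , val , t∈ , proj₁ (sorted-≈ s) w∈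
      ... | inj₂ x∉   = ⊥-elim (x∉ x∈)

      under-apex : ∀ {x v} → x ∈ᵤ U → Reach T x v → UnderApex x v
      under-apex x∈ (one t∈ p q)    = under-next (inj₁ (refl , x∈)) t∈ p q
      under-apex x∈ (step r t∈ p q) = under-next (inj₂ (under-apex x∈ r)) t∈ p q

      contradictory : Fin N → ⊥
      contradictory v =
        -- The vertex v serves only to obtain some x in U; the next line gives a different y in U.
        -- Everything reached from x lies under the apex x, and the only member of U there is x
        -- itself.
        third-element 3≤∣U∣ v v λ x x∈ _ _ →
        third-element 3≤∣U∣ x x λ y y∈ y≢x _ →
        let _ , _ , val , _ , y∈t = under-apex x∈ (connected x y) in
        [ y≢x , (λ y∉ → y∉ y∈) ]′ (apex-or-base val y∈t)

theorem5p2 : (N k : ℕ) (U : Subset N) (E : Fin N → Fin N → Set) →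
    IsGraphOff U E → 3 ≤ k → ∣ U ∣ ≡ k →
    (∃ λ (T : List (Triple N)) → SpanningTree U E T) →
    (ω : Orientation N) → ¬ Is3Pfaffian U E ω
theorem5p2 zero    _ [] E G () refl (T , span) ω pfaffian
theorem5p2 (suc _) _ U  E G 3≤ refl (T , span) ω pfaffian = contradictory G 3≤ ω pfaffian span zero
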